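{- As formal power series in $x$, $D^{\mathsf{cpk}}(-1;x)=G(x)^{ -1}$.
   Context: Let $\mathfrak{D}_n$ be the set of derangements of $[n]=\{1,\dots,n\}$, i.e. permutations $\pi=\pi_1\cdots\pi_n$ (one-line notation, $\pi_i=\pi(i)$) with $\pi_i\ne i$ for all $i$. For a permutation $\pi$ of $[n]$, the letter $\pi_i$ is a cyclic peak if $i<\pi_i>\pi_{\pi_i}$; let $\mathsf{cpk}(\pi)$ be the number of cyclic peaks of $\pi$. Define $D_n^{\mathsf{cpk}}(t)=\sum_{\pi\in\mathfrak{D}_n}t^{\mathsf{cpk}(\pi)}$ and $D^{\mathsf{cpk}}(t;x)=1+\sum_{n=1}^\infty D_n^{\mathsf{cpk}}(t)\frac{x^n}{n!}$. Let the (shifted) Pell numbers be defined by $g_0=1$, $g_1=0$, and $g_n=2g_{n-1}+g_{n-2}$ for $n\ge2$, and let $G(x)=\sum_{n\ge0}g_n\frac{x^n}{n!}$. -}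

module Defs where

open import Data.Fin using (Fin; toℕ; _<_; _>_)
open import Data.Fin.Properties using (_≟_; _<?_; all?; any?)
open import Data.Integer as ℤ using (ℤ; +_; 0ℤ)
open import Data.List using (List; []; _∷_; [_]; allFin; cartesianProductWith; filter; foldr; length; map)
open import Data.Nat as ℕ using (ℕ; zero; suc; _∸_; _!)
open import Data.Nat.Properties using (_!≢0)
open import Data.Product using (_×_)
open import Data.Rational as ℚ using (ℚ; 0ℚ; 1ℚ; _/_)
open import Data.Rational.Properties using (+-0-commutativeMonoid)
open import Data.Vec as Vec using (Vec; lookup)
open import Function.Consequences.Propositional using (strictlySurjective⇒surjective; surjective⇒strictlySurjective)
open import Function.Definitions using (Bijective)
open import Relation.Binary.PropositionalEquality using (_≡_; _≢_; _≗_)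
open import Relation.Nullary using (Dec)
open import Relation.Nullary.Decidable using (map′; ¬?; _×-dec_; _→-dec_)

open import Algebra.Properties.CommutativeMonoid.Sum +-0-commutativeMonoid using (sum)

-- A word of length n over the alphabet Fin n is the one-line notation
-- π₁ ⋯ πₙ, with the letters 1 , … , n shifted down to 0 , … , n - 1.

Word : ℕ → Set
Word n = Vec (Fin n) n

IsPermutation : ∀ {n} → Word n → Set
IsPermutation π = Bijective _≡_ _≡_ (lookup π)

FixedPointFree : ∀ {n} → Word n → Set
FixedPointFree π = ∀ i → lookup π i ≢ i

IsDerangement : ∀ {n} → Word n → Set
IsDerangement π = IsPermutation π × FixedPointFree π

-- The letter in position i is a cyclic peak: i < πᵢ > π_{πᵢ}.

IsCyclicPeak : ∀ {n} → Word n → Fin n → Set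
IsCyclicPeak π i = i < lookup π i × lookup π i > lookup π (lookup π i)

isPermutation? : ∀ {n} (π : Word n) → Dec (IsPermutation π)
isPermutation? π =
  map′ (λ inj {i} {j} → inj i j) (λ inj i j → inj {i} {j})
       (all? λ i → all? λ j → (lookup π i ≟ lookup π j) →-dec (i ≟ j))
  ×-dec
  map′ strictlySurjective⇒surjective surjective⇒strictlySurjective
       (all? λ j → any? λ i → lookup π i ≟ j)

isDerangement? : ∀ {n} (π : Word n) → Dec (IsDerangement π)
isDerangement? π = isPermutation? π ×-dec all? λ i → ¬? (lookup π i ≟ i)

isCyclicPeak? : ∀ {n} (π : Word n) (i : Fin n) → Dec (IsCyclicPeak π i)
isCyclicPeak? π i =
  (i <? lookup π i) ×-dec (lookup π (lookup π i) <? lookup π i)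

-- Every vector occurs exactly once.

allVecs : ∀ m n → List (Vec (Fin m) n)
allVecs m zero    = [ Vec.[] ]
allVecs m (suc n) = cartesianProductWith Vec._∷_ (allFin m) (allVecs m n)

derangements : ∀ n → List (Word n)
derangements n = filter isDerangement? (allVecs n n)

cpk : ∀ {n} → Word n → ℕ
cpk {n} π = length (filter (isCyclicPeak? π) (allFin n))

-- The value at the integer t of the polynomial Dₙ^cpk.

D[_]^cpk : ℕ → ℤ → ℤ
D[ n ]^cpk t = foldr ℤ._+_ 0ℤ (map (λ π → t ℤ.^ cpk π) (derangements n))

-- A formal power series over ℚ is its sequence of coefficients.

Series : Set
Series = ℕ → ℚ

one : Series
one zero    = 1ℚ
one (suc n) = 0ℚ

infixl 7 _⊛_
_⊛_ : Series → Series → Series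
(F ⊛ H) n = sum {suc n} λ k → F (toℕ k) ℚ.* H (n ∸ toℕ k)

infix 4 _IsInverseOf_
_IsInverseOf_ : Series → Series → Set
F IsInverseOf H = (F ⊛ H ≗ one) × (H ⊛ F ≗ one)

D^cpk : ℤ → Series
D^cpk t zero    = 1ℚ
D^cpk t (suc n) = (D[ suc n ]^cpk t / (suc n !)) {{suc n !≢0}}

g : ℕ → ℕ
g zero          = 1
g (suc zero)    = 0
g (suc (suc n)) = 2 ℕ.* g (suc n) ℕ.+ g n

G : Series
G n = ((+ g n) / (n !)) {{n !≢0}}

{-# OPTIONS --safe #-}
-- Inserting a new smallest letter into the cycle decompositions of the
-- permutations of n letters gives
--   Dₙ₊₁ = n t (Dₙ₋₁ + Dₙ) + 2 t (1 - t) Dₙ′,   where Dₙ = Dₙ^cpk(t).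
-- The polynomials g₀ = 1, g₁ = 0, gₙ₊₂ = 2 gₙ₊₁ - t gₙ, which are the Pell
-- numbers at t = -1, satisfy
--   gₙ₊₁ = n t (gₙ - gₙ₋₁) + 2 t (1 - t) gₙ′.
-- Hence cₙ = Σ C(n,k) Dₖ gₙ₋ₖ satisfies cₙ₊₁ = n t cₙ + 2 t (1 - t) cₙ′, and
-- since c₀ = 1 is constant, c₁ and all later cₙ vanish.

module Submission where

open import Defs
open import Data.Integer using (-1ℤ)
open import Data.Fin using (Fin; zero; suc; toℕ; punchOut; _<_)
open import Data.Fin.Permutation using (permutation)
open import Data.Fin.Properties using (_≟_; _<?_; suc-injective; 0≢1+n; punchIn-punchOut; <-cmp; <-irrefl)
open import Data.Integer as ℤ using (ℤ; +_; 0ℤ; 1ℤ)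
import Data.Integer.Properties as ℤ
import Data.Integer.Tactic.RingSolver as ℤ
open import Data.List as List using (List; []; _∷_; _++_; filter; length; allFin; map; foldr; cartesianProductWith)
open import Data.List.Membership.Propositional using (_∈_)
open import Data.List.Membership.Propositional.Properties
  using (∈-allFin; ∈-cartesianProductWith⁺; ∈-cartesianProductWith⁻; ∈-filter⁺; ∈-filter⁻)
open import Data.List.Membership.Propositional.Properties.WithK using (unique∧set⇒bag)
open import Data.List.Properties using (filter-accept; filter-reject; filter-none)
open import Data.List.Relation.Binary.BagAndSetEquality using (∼bag⇒↭)
open import Data.List.Relation.Binary.Permutation.Propositional using (_↭_; ↭⇒↭ₛ)
open import Data.List.Relation.Binary.Permutation.Propositional.Properties using (map⁺)
open import Data.List.Relation.Binary.Permutation.Setoid.Properties using (foldr-commMonoid)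
open import Data.List.Relation.Unary.All as All using ([])
open import Data.List.Relation.Unary.AllPairs using ([]; _∷_)
open import Data.List.Relation.Unary.Any using (here)
open import Data.List.Relation.Unary.Unique.Propositional using (Unique)
open import Data.List.Relation.Unary.Unique.Propositional.Properties
  using (allFin⁺; cartesianProductWith⁺; filter⁺)
open import Data.Maybe using (nothing)
open import Data.Nat as ℕ using (ℕ; zero; suc; pred; _∸_; _!; NonZero; s<s; s<s⁻¹; z<s)
import Data.Nat.Properties as ℕ
open import Data.Product using (_×_; _,_; proj₁; proj₂; ∃; ∃₂)
open import Data.Sum using (_⊎_; inj₁; inj₂)
open import Data.Vec as Vec using (Vec; []; _∷_; lookup; _[_]≔_)
open import Data.Vec.Properties
  using (lookup-map; lookup∘update; lookup∘update′; lookup∘tabulate; tabulate∘lookup; tabulate-cong; ∷-injective)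
open import Function using (_∘_; id; mk⇔)
open import Function.Consequences.Propositional using (strictlySurjective⇒surjective)
open import Level using (0ℓ)
open import Relation.Binary.Definitions using (tri<; tri≈; tri>)
open import Relation.Binary.PropositionalEquality
open import Relation.Nullary using (Dec; yes; no; ¬_; contradiction)
open import Relation.Nullary.Decidable using (_×-dec_)
open import Relation.Unary using (Pred; Decidable)

open ≡-Reasoning

-- The recurrence of Dₙ contains a derivative, so its values at t = -1 alone do not determine one
-- another. Hence the Pell numbers are deformed to polynomials in t, the product is shown to be 1
-- for all t, and only then is t set to -1. A polynomial is kept as a functional on sequences:
-- multiplication by t and differentiation become operations on a test sequence, and t = -1 is the
-- choice of the test sequence (-1)ᵖ. Two mechanisms give the recurrence of cₙ. The terms k t Dₖ₋₁
-- gₗ and -l t Dₖ gₗ₋₁ have opposite binomial sums, and the remaining operators f ↦ k t f + 2 t (1 -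
-- t) f′ obey a product rule in which the weights k and l add up to n. Derangements are not closed
-- under removal of the smallest letter: a 2-cycle containing it leaves a fixed point behind. So
-- fixed points and cyclic peaks are counted jointly over all permutations, and derangements are
-- recovered as the part without fixed points.

-- Binomial sums of integer arrays

module BinomialSum where

  open import Data.Integer using (_+_; _*_; -_)
  open import Data.Integer.Properties using (+-identityˡ)
  open import Data.Integer.Tactic.RingSolver using (solve-∀)

  -- The sum of C(n,i) h(i,j) over i + j = n, unfolded by Pascal's rule.

  binomialSum : ℕ → (ℕ → ℕ → ℤ) → ℤ
  binomialSum zero    h = h 0 0
  binomialSum (suc n) h = binomialSum n λ i j → h (suc i) j + h i (suc j)

  -- The hypothesis i + j ≡ n is what later allows a coefficient n to be split into the weights of
  -- the two factors.
  binomialSum-cong : ∀ n {h h′} → (∀ i j → i ℕ.+ j ≡ n → h i j ≡ h′ i j) →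
                     binomialSum n h ≡ binomialSum n h′
  binomialSum-cong zero    eq = eq 0 0 refl
  binomialSum-cong (suc n) eq = binomialSum-cong n λ i j i+j≡n →
    cong₂ _+_ (eq (suc i) j (cong suc i+j≡n)) (eq i (suc j) (trans (ℕ.+-suc i j) (cong suc i+j≡n)))

  binomialSum-+ : ∀ n h h′ →
                  binomialSum n (λ i j → h i j + h′ i j) ≡ binomialSum n h + binomialSum n h′
  binomialSum-+ zero    h h′ = refl
  binomialSum-+ (suc n) h h′ = trans
    (binomialSum-cong n λ i j _ → interchange (h (suc i) j) (h′ (suc i) j) (h i (suc j)) (h′ i (suc j)))
    (binomialSum-+ n (λ i j → h (suc i) j + h i (suc j)) (λ i j → h′ (suc i) j + h′ i (suc j)))
    where
    interchange : ∀ a b c d → (a + b) + (c + d) ≡ (a + c) + (b + d)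
    interchange = solve-∀

  binomialSum-neg : ∀ n h → binomialSum n (λ i j → - h i j) ≡ - binomialSum n h
  binomialSum-neg zero    h = refl
  binomialSum-neg (suc n) h = trans
    (binomialSum-cong n λ i j _ → neg-+ (h (suc i) j) (h i (suc j)))
    (binomialSum-neg n (λ i j → h (suc i) j + h i (suc j)))
    where
    neg-+ : ∀ a b → - a + - b ≡ - (a + b)
    neg-+ = solve-∀

  binomialSum-swap : ∀ n h → binomialSum n (λ i j → h j i) ≡ binomialSum n h
  binomialSum-swap zero    h = refl
  binomialSum-swap (suc n) h = trans
    (binomialSum-cong n λ i j _ → comm (h j (suc i)) (h (suc j) i))
    (binomialSum-swap n (λ i j → h (suc i) j + h i (suc j)))
    where
    comm : ∀ a b → a + b ≡ b + a
    comm = solve-∀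

  -- Both sides are n times the binomial sum of h over i + j = n - 1.

  binomialSum-absorb : ∀ n (h : ℕ → ℕ → ℤ) →
    binomialSum n (λ i j → + i * h (pred i) j) ≡ binomialSum n (λ i j → + j * h i (pred j))
  binomialSum-absorb zero    h = refl
  binomialSum-absorb (suc n) h = begin
    binomialSum n (λ i j → + suc i * h i j + + i * h (pred i) (suc j))
      ≡⟨ binomialSum-cong n (λ i j _ → left i j) ⟩
    binomialSum n (λ i j → h i j + (+ i * h (suc (pred i)) j + + i * h (pred i) (suc j)))
      ≡⟨ split (λ i j → + i * h (suc (pred i)) j) (λ i j → + i * h (pred i) (suc j)) ⟩
    binomialSum n h + (binomialSum n (λ i j → + i * h (suc (pred i)) j)
                     + binomialSum n (λ i j → + i * h (pred i) (suc j)))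
      ≡⟨ cong₂ _+_ (refl {x = binomialSum n h}) (cong₂ _+_ (binomialSum-absorb n (λ i j → h (suc i) j))
                                               (binomialSum-absorb n (λ i j → h i (suc j)))) ⟩
    binomialSum n h + (binomialSum n (λ i j → + j * h (suc i) (pred j))
                     + binomialSum n (λ i j → + j * h i (suc (pred j))))
      ≡⟨ split (λ i j → + j * h (suc i) (pred j)) (λ i j → + j * h i (suc (pred j))) ⟨
    binomialSum n (λ i j → h i j + (+ j * h (suc i) (pred j) + + j * h i (suc (pred j))))
      ≡⟨ binomialSum-cong n (λ i j _ → right i j) ⟩
    binomialSum n (λ i j → + j * h (suc i) (pred j) + + suc j * h i j) ∎
    where
    split : ∀ f f′ → binomialSum n (λ i j → h i j + (f i j + f′ i j))
                   ≡ binomialSum n h + (binomialSum n f + binomialSum n f′)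
    split f f′ = trans (binomialSum-+ n h (λ i j → f i j + f′ i j))
                       (cong₂ _+_ (refl {x = binomialSum n h}) (binomialSum-+ n f f′))
    zeroˡ : ∀ a b c → (+ 1) * a + 0ℤ * b ≡ a + (0ℤ * c + 0ℤ * b)
    zeroˡ = solve-∀
    zeroʳ : ∀ a b c → a + (0ℤ * b + 0ℤ * c) ≡ 0ℤ * b + (+ 1) * a
    zeroʳ = solve-∀
    sucˡ : ∀ k a b → (1ℤ + k) * a + k * b ≡ a + (k * a + k * b)
    sucˡ = solve-∀
    sucʳ : ∀ k a b → a + (k * b + k * a) ≡ k * b + (1ℤ + k) * a
    sucʳ = solve-∀
    -- The form `suc (pred i)` is the one that the induction hypothesis for `λ i j → h (suc i) j`
    -- delivers. It differs from i only at i = 0, where the coefficient is 0.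
    left : ∀ i j → + suc i * h i j + + i * h (pred i) (suc j)
                 ≡ h i j + (+ i * h (suc (pred i)) j + + i * h (pred i) (suc j))
    left zero    j = zeroˡ (h 0 j) (h 0 (suc j)) (h 1 j)
    left (suc i) j = sucˡ (+ suc i) (h (suc i) j) (h i (suc j))
    right : ∀ i j → h i j + (+ j * h (suc i) (pred j) + + j * h i (suc (pred j)))
                  ≡ + j * h (suc i) (pred j) + + suc j * h i j
    right i zero    = zeroʳ (h i 0) (h (suc i) 0) (h i 1)
    right i (suc j) = sucʳ (+ suc j) (h i (suc j)) (h (suc i) j)

  binomialSum-first : ∀ n h → (∀ i j → h (suc i) j ≡ 0ℤ) → binomialSum n h ≡ h 0 n
  binomialSum-first zero    h h≡0 = refl
  binomialSum-first (suc n) h h≡0 = trans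
    (binomialSum-first n (λ i j → h (suc i) j + h i (suc j))
       λ i j → cong₂ _+_ (h≡0 (suc i) j) (h≡0 i (suc j)))
    (trans (cong (_+ h 0 (suc n)) (h≡0 0 n)) (+-identityˡ _))

open BinomialSum

-- Exponential generating series over the rationals

module ExponentialSeries where

  open import Algebra using (CommutativeRing)
  open import Data.Rational using (ℚ; 0ℚ; _/_; _+_; _*_; fromℚᵘ)
  open import Data.Rational.Properties
    using (+-*-commutativeRing; +-0-commutativeMonoid; +-identityˡ; +-identityʳ; +-assoc; *-identityˡ; *-zeroˡ;
           toℚᵘ-injective; toℚᵘ-fromℚᵘ; toℚᵘ-homo-+; toℚᵘ-homo-*; fromℚᵘ-cong)
  open import Data.Rational.Unnormalised as ℚᵘ using (mkℚᵘ; *≡*)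
  import Data.Rational.Unnormalised.Properties as ℚᵘ
  open import Algebra.Properties.CommutativeMonoid.Sum +-0-commutativeMonoid using (sum; ∑-distrib-+)
  open import Algebra.Properties.Semiring.Sum (CommutativeRing.semiring +-*-commutativeRing)
    using (*-distribˡ-sum)
  open import Tactic.RingSolver using (solve-∀)
  open import Tactic.RingSolver.Core.AlmostCommutativeRing using (AlmostCommutativeRing; fromCommutativeRing)

  ℚ-ring : AlmostCommutativeRing 0ℓ 0ℓ
  ℚ-ring = fromCommutativeRing +-*-commutativeRing λ _ → nothing

  fromℚᵘ-homo-+ : ∀ p q → fromℚᵘ (p ℚᵘ.+ q) ≡ fromℚᵘ p + fromℚᵘ q
  fromℚᵘ-homo-+ p q = toℚᵘ-injective (ℚᵘ.≃-trans (toℚᵘ-fromℚᵘ (p ℚᵘ.+ q)) (ℚᵘ.≃-sym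
    (ℚᵘ.≃-trans (toℚᵘ-homo-+ (fromℚᵘ p) (fromℚᵘ q)) (ℚᵘ.+-cong (toℚᵘ-fromℚᵘ p) (toℚᵘ-fromℚᵘ q)))))

  fromℚᵘ-homo-* : ∀ p q → fromℚᵘ (p ℚᵘ.* q) ≡ fromℚᵘ p * fromℚᵘ q
  fromℚᵘ-homo-* p q = toℚᵘ-injective (ℚᵘ.≃-trans (toℚᵘ-fromℚᵘ (p ℚᵘ.* q)) (ℚᵘ.≃-sym
    (ℚᵘ.≃-trans (toℚᵘ-homo-* (fromℚᵘ p) (fromℚᵘ q)) (ℚᵘ.*-cong (toℚᵘ-fromℚᵘ p) (toℚᵘ-fromℚᵘ q)))))

  fromℤ : ℤ → ℚ
  fromℤ z = z / 1

  fromℤ-homo-+ : ∀ y z → fromℤ (y ℤ.+ z) ≡ fromℤ y + fromℤ z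
  fromℤ-homo-+ y z = trans (cong fromℤ (lemma y z)) (fromℚᵘ-homo-+ (mkℚᵘ y 0) (mkℚᵘ z 0))
    where
    lemma : ∀ y z → y ℤ.+ z ≡ y ℤ.* 1ℤ ℤ.+ z ℤ.* 1ℤ
    lemma = ℤ.solve-∀

  fromℤ-homo-* : ∀ y z → fromℤ (y ℤ.* z) ≡ fromℤ y * fromℤ z
  fromℤ-homo-* y z = fromℚᵘ-homo-* (mkℚᵘ y 0) (mkℚᵘ z 0)

  /-split : ∀ z m .{{_ : NonZero m}} → z / m ≡ fromℤ z * (1ℤ / m)
  /-split z (suc d) = trans (fromℚᵘ-cong {mkℚᵘ z d} {mkℚᵘ z 0 ℚᵘ.* mkℚᵘ 1ℤ d} (*≡* eq))
                            (fromℚᵘ-homo-* (mkℚᵘ z 0) (mkℚᵘ 1ℤ d))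
    where
    eq : z ℤ.* + (1 ℕ.* suc d) ≡ z ℤ.* 1ℤ ℤ.* + suc d
    eq rewrite ℕ.+-identityʳ d = cong (ℤ._* + suc d) (sym (ℤ.*-identityʳ z))

  /-cancelˡ : ∀ c m .{{_ : NonZero m}} .{{_ : NonZero (suc c ℕ.* m)}} →
              fromℤ (+ suc c) * (1ℤ / (suc c ℕ.* m)) ≡ 1ℤ / m
  /-cancelˡ c (suc d) = trans (sym (fromℚᵘ-homo-* (mkℚᵘ (+ suc c) 0) (mkℚᵘ 1ℤ (d ℕ.+ c ℕ.* suc d))))
    (fromℚᵘ-cong {mkℚᵘ (+ suc c) 0 ℚᵘ.* mkℚᵘ 1ℤ (d ℕ.+ c ℕ.* suc d)} {mkℚᵘ 1ℤ d} (*≡* eq))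
    where
    eq : + suc c ℤ.* 1ℤ ℤ.* + suc d ≡ 1ℤ ℤ.* + (1 ℕ.* (suc c ℕ.* suc d))
    eq = begin
      + suc c ℤ.* 1ℤ ℤ.* + suc d ≡⟨ cong (ℤ._* + suc d) (ℤ.*-identityʳ (+ suc c)) ⟩
      + suc c ℤ.* + suc d ≡⟨ ℤ.pos-* (suc c) (suc d) ⟨
      + (suc c ℕ.* suc d) ≡⟨ cong +_ (ℕ.*-identityˡ _) ⟨
      + (1 ℕ.* (suc c ℕ.* suc d)) ≡⟨ ℤ.*-identityˡ _ ⟨
      1ℤ ℤ.* + (1 ℕ.* (suc c ℕ.* suc d)) ∎

  _!⁻¹ : ℕ → ℚ
  n !⁻¹ = (1ℤ / (n !)) {{n ℕ.!≢0}}

  !⁻¹-suc : ∀ n → fromℤ (+ suc n) * suc n !⁻¹ ≡ n !⁻¹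
  !⁻¹-suc n = /-cancelˡ n (n !) {{n ℕ.!≢0}} {{suc n ℕ.!≢0}}

  antidiagonalSum : ℕ → (ℕ → ℕ → ℚ) → ℚ
  antidiagonalSum n v = sum {suc n} λ k → v (toℕ k) (n ∸ toℕ k)

  antidiagonalSum-cong : ∀ n {v v′} → (∀ k l → k ℕ.+ l ≡ n → v k l ≡ v′ k l) →
                         antidiagonalSum n v ≡ antidiagonalSum n v′
  antidiagonalSum-cong zero    eq = cong (_+ 0ℚ) (eq 0 0 refl)
  antidiagonalSum-cong (suc n) eq = cong₂ _+_ (eq 0 (suc n) refl)
    (antidiagonalSum-cong n λ k l k+l≡n → eq (suc k) l (cong suc k+l≡n))

  antidiagonalSum-last : ∀ n v →
    antidiagonalSum (suc n) v ≡ antidiagonalSum n (λ k l → v k (suc l)) + v (suc n) 0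
  antidiagonalSum-last zero    v = trans (cong (λ z → v 0 1 + z) (+-identityʳ (v 1 0)))
    (cong (_+ v 1 0) (sym (+-identityʳ (v 0 1))))
  antidiagonalSum-last (suc n) v = trans
    (cong (λ z → v 0 (suc (suc n)) + z) (antidiagonalSum-last n (λ k l → v (suc k) l)))
    (sym (+-assoc (v 0 (suc (suc n))) _ _))

  antidiagonalSum-+ : ∀ n v v′ →
    antidiagonalSum n (λ k l → v k l + v′ k l) ≡ antidiagonalSum n v + antidiagonalSum n v′
  antidiagonalSum-+ n v v′ = ∑-distrib-+ {suc n} (λ k → v (toℕ k) (n ∸ toℕ k)) (λ k → v′ (toℕ k) (n ∸ toℕ k))

  antidiagonalSum-* : ∀ n c v → antidiagonalSum n (λ k l → c * v k l) ≡ c * antidiagonalSum n v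
  antidiagonalSum-* n c v = sym (*-distribˡ-sum {suc n} c (λ k → v (toℕ k) (n ∸ toℕ k)))

  -- The factor n + 1 is the weight k + l of every term v k l.

  antidiagonalSum-suc : ∀ n v → fromℤ (+ suc n) * antidiagonalSum (suc n) v ≡
    antidiagonalSum n λ k l → fromℤ (+ suc k) * v (suc k) l + fromℤ (+ suc l) * v k (suc l)
  antidiagonalSum-suc n v = begin
    fromℤ (+ suc n) * antidiagonalSum (suc n) v
      ≡⟨ antidiagonalSum-* (suc n) (fromℤ (+ suc n)) v ⟨
    antidiagonalSum (suc n) (λ k l → fromℤ (+ suc n) * v k l)
      ≡⟨ antidiagonalSum-cong (suc n) weight ⟩
    antidiagonalSum (suc n) (λ k l → K k l + L k l)
      ≡⟨ antidiagonalSum-+ (suc n) K L ⟩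
    antidiagonalSum (suc n) K + antidiagonalSum (suc n) L
      ≡⟨ cong₂ _+_ (trans (cong (_+ antidiagonalSum n (λ k l → K (suc k) l)) (*-zeroˡ (v 0 (suc n)))) (+-identityˡ (antidiagonalSum n (λ k l → K (suc k) l))))
           (trans (antidiagonalSum-last n L)
             (trans (cong (λ z → antidiagonalSum n (λ k l → L k (suc l)) + z) (*-zeroˡ (v (suc n) 0))) (+-identityʳ (antidiagonalSum n (λ k l → L k (suc l)))))) ⟩
    antidiagonalSum n (λ k l → K (suc k) l) + antidiagonalSum n (λ k l → L k (suc l))
      ≡⟨ antidiagonalSum-+ n (λ k l → K (suc k) l) (λ k l → L k (suc l)) ⟨
    antidiagonalSum n (λ k l → K (suc k) l + L k (suc l)) ∎
    where
    K L : ℕ → ℕ → ℚ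
    K k l = fromℤ (+ k) * v k l
    L k l = fromℤ (+ l) * v k l
    distrib : ∀ a b c → (a + b) * c ≡ a * c + b * c
    distrib = solve-∀ ℚ-ring
    weight : ∀ k l → k ℕ.+ l ≡ suc n → fromℤ (+ suc n) * v k l ≡ K k l + L k l
    weight k l k+l≡1+n = begin
      fromℤ (+ suc n) * v k l ≡⟨ cong (λ m → fromℤ (+ m) * v k l) k+l≡1+n ⟨
      fromℤ (+ k ℤ.+ + l) * v k l ≡⟨ cong (_* v k l) (fromℤ-homo-+ (+ k) (+ l)) ⟩
      (fromℤ (+ k) + fromℤ (+ l)) * v k l ≡⟨ distrib (fromℤ (+ k)) (fromℤ (+ l)) (v k l) ⟩
      K k l + L k l ∎

  fromℤ-cancelˡ : ∀ n {p q} → fromℤ (+ suc n) * p ≡ fromℤ (+ suc n) * q → p ≡ q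
  fromℤ-cancelˡ n {p} {q} eq = trans (sym (undo p)) (trans (cong (c⁻¹ *_) eq) (undo q))
    where
    -- The factor 1 gives the denominator the shape that `/-cancelˡ n 1` expects.
    c⁻¹ = 1ℤ / (suc n ℕ.* 1)
    swap : ∀ a b x → b * (a * x) ≡ (a * b) * x
    swap = solve-∀ ℚ-ring
    undo : ∀ x → c⁻¹ * (fromℤ (+ suc n) * x) ≡ x
    undo x = trans (swap (fromℤ (+ suc n)) c⁻¹ x) (trans (cong (_* x) (/-cancelˡ n 1)) (*-identityˡ x))

  -- Multiplication by n + 1 acts on the antidiagonal sum like a derivative: by
  -- `antidiagonalSum-suc` it lowers either index, and (k + 1) / (k + 1)! = 1 / k! turns the result
  -- into the antidiagonal sum of the Pascal step of `h`. So both sides satisfy the same recursion,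
  -- and no quotient of factorials has to be identified with a binomial coefficient.
  antidiagonalSum-binomial : ∀ n h →
    antidiagonalSum n (λ k l → fromℤ (h k l) * (k !⁻¹ * l !⁻¹)) ≡ fromℤ (binomialSum n h) * n !⁻¹
  antidiagonalSum-binomial zero    h = +-identityʳ _
  antidiagonalSum-binomial (suc n) h = fromℤ-cancelˡ n (begin
    fromℤ (+ suc n) * antidiagonalSum (suc n) (u h)
      ≡⟨ antidiagonalSum-suc n (u h) ⟩
    antidiagonalSum n (λ k l → fromℤ (+ suc k) * u h (suc k) l + fromℤ (+ suc l) * u h k (suc l))
      ≡⟨ antidiagonalSum-cong n (λ k l _ → combine k l) ⟩
    antidiagonalSum n (u (λ k l → h (suc k) l ℤ.+ h k (suc l)))
      ≡⟨ antidiagonalSum-binomial n _ ⟩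
    b * n !⁻¹
      ≡⟨ cong (b *_) (!⁻¹-suc n) ⟨
    b * (fromℤ (+ suc n) * suc n !⁻¹)
      ≡⟨ exchange b (fromℤ (+ suc n)) (suc n !⁻¹) ⟩
    fromℤ (+ suc n) * (b * suc n !⁻¹) ∎)
    where
    b = fromℤ (binomialSum (suc n) h)
    u : (ℕ → ℕ → ℤ) → ℕ → ℕ → ℚ
    u h k l = fromℤ (h k l) * (k !⁻¹ * l !⁻¹)
    exchange : ∀ a b c → a * (b * c) ≡ b * (a * c)
    exchange = solve-∀ ℚ-ring
    gather : ∀ s t x y p q r w → s * (x * (p * q)) + t * (y * (r * w)) ≡ x * ((s * p) * q) + y * (r * (t * w))
    gather = solve-∀ ℚ-ring
    factor : ∀ x y p → x * p + y * p ≡ (x + y) * p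
    factor = solve-∀ ℚ-ring
    combine : ∀ k l → fromℤ (+ suc k) * u h (suc k) l + fromℤ (+ suc l) * u h k (suc l)
                    ≡ u (λ k l → h (suc k) l ℤ.+ h k (suc l)) k l
    combine k l = begin
      fromℤ (+ suc k) * u h (suc k) l + fromℤ (+ suc l) * u h k (suc l)
        ≡⟨ gather (fromℤ (+ suc k)) (fromℤ (+ suc l)) x y (suc k !⁻¹) (l !⁻¹) (k !⁻¹) (suc l !⁻¹) ⟩
      x * ((fromℤ (+ suc k) * suc k !⁻¹) * l !⁻¹) + y * (k !⁻¹ * (fromℤ (+ suc l) * suc l !⁻¹))
        ≡⟨ cong₂ (λ p q → x * (p * l !⁻¹) + y * (k !⁻¹ * q)) (!⁻¹-suc k) (!⁻¹-suc l) ⟩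
      x * (k !⁻¹ * l !⁻¹) + y * (k !⁻¹ * l !⁻¹)
        ≡⟨ factor x y (k !⁻¹ * l !⁻¹) ⟩
      (x + y) * (k !⁻¹ * l !⁻¹)
        ≡⟨ cong (_* (k !⁻¹ * l !⁻¹)) (fromℤ-homo-+ (h (suc k) l) (h k (suc l))) ⟨
      u (λ k l → h (suc k) l ℤ.+ h k (suc l)) k l ∎
      where
      x = fromℤ (h (suc k) l)
      y = fromℤ (h k (suc l))

  exponential : (ℕ → ℤ) → Series
  exponential a n = fromℤ (a n) * n !⁻¹

  exponential-⊛ : ∀ a b {F H} → F ≗ exponential a → H ≗ exponential b →
                  ∀ n → (F ⊛ H) n ≡ exponential (λ n → binomialSum n λ k l → a k ℤ.* b l) n
  exponential-⊛ a b {F} {H} F≗ H≗ n = begin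
    (F ⊛ H) n
      ≡⟨ antidiagonalSum-cong n {λ k l → F k * H l} (λ k l _ → trans (cong₂ _*_ (F≗ k) (H≗ l)) (regroup k l)) ⟩
    antidiagonalSum n (λ k l → fromℤ (a k ℤ.* b l) * (k !⁻¹ * l !⁻¹))
      ≡⟨ antidiagonalSum-binomial n (λ k l → a k ℤ.* b l) ⟩
    exponential (λ n → binomialSum n λ k l → a k ℤ.* b l) n ∎
    where
    interchange : ∀ x y p q → (x * p) * (y * q) ≡ (x * y) * (p * q)
    interchange = solve-∀ ℚ-ring
    regroup : ∀ k l → exponential a k * exponential b l ≡ fromℤ (a k ℤ.* b l) * (k !⁻¹ * l !⁻¹)
    regroup k l = trans (interchange (fromℤ (a k)) (fromℤ (b l)) (k !⁻¹) (l !⁻¹))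
      (cong (_* (k !⁻¹ * l !⁻¹)) (sym (fromℤ-homo-* (a k) (b l))))

  exponential-one : ∀ a → a 0 ≡ 1ℤ → (∀ n → a (suc n) ≡ 0ℤ) → exponential a ≗ one
  exponential-one a a₀≡1 aₙ≡0 zero    = cong (λ z → fromℤ z * 0 !⁻¹) a₀≡1
  exponential-one a a₀≡1 aₙ≡0 (suc n) = trans (cong (λ z → fromℤ z * suc n !⁻¹) (aₙ≡0 n)) (*-zeroˡ (suc n !⁻¹))

  D^cpk-exponential : ∀ t → D^cpk t ≗ exponential (λ n → D[ n ]^cpk t)
  -- The constant term 1 agrees with D₀: the empty word is the one derangement of no letters and has
  -- no cyclic peak.
  D^cpk-exponential t zero    = refl
  D^cpk-exponential t (suc n) = /-split (D[ suc n ]^cpk t) (suc n !) {{suc n ℕ.!≢0}}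

  G-exponential : G ≗ exponential (λ n → + g n)
  G-exponential n = /-split (+ g n) (n !) {{n ℕ.!≢0}}

open ExponentialSeries using (exponential-⊛; exponential-one; D^cpk-exponential; G-exponential)

open import Data.Integer using (_+_; _*_; -_; _-_; _^_)
open import Data.Integer.Properties
  using (+-*-semiring; +-0-commutativeMonoid; +-0-isCommutativeMonoid; +-assoc; +-identityˡ; +-identityʳ; +-injective;
         *-comm; *-identityˡ; *-zeroʳ; -1*i≡-i; ^-distribˡ-+-*; pos-*)
open import Data.Integer.Tactic.RingSolver using (solve-∀)
open import Algebra.Properties.CommutativeMonoid.Sum +-0-commutativeMonoid
  using (sum; sum-cong-≗; ∑-distrib-+; sum-permute)
open import Algebra.Properties.Semiring.Sum +-*-semiring using (*-distribˡ-sum; *-distribʳ-sum)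

-- Polynomials as functionals

-- A polynomial Σ aₚ tᵖ is represented by the functional ψ ↦ Σ aₚ ψ(p);
-- multiplication by t is precomposition with shift.

Functional : Set
Functional = (ℕ → ℤ) → ℤ

-- `respects` stands in for function extensionality: the test sequences under `F` are rewritten only
-- pointwise.
record Linear (F : Functional) : Set where
  field
    respects : ∀ {ψ χ} → ψ ≗ χ → F ψ ≡ F χ
    additive : ∀ ψ χ → F (λ p → ψ p + χ p) ≡ F ψ + F χ
    homogeneous : ∀ c ψ → F (λ p → c * ψ p) ≡ c * F ψ

open Linear

linear-0 : ∀ {F} → Linear F → ∀ {ψ} → (∀ p → ψ p ≡ 0ℤ) → F ψ ≡ 0ℤ
linear-0 {F} lin ψ≡0 = trans (respects lin ψ≡0) (homogeneous lin 0ℤ (λ _ → 0ℤ))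

linear-neg : ∀ {F} → Linear F → ∀ ψ → F (λ p → - ψ p) ≡ - F ψ
linear-neg lin ψ = begin
  _                 ≡⟨ respects lin (λ p → sym (-1*i≡-i (ψ p))) ⟩
  _                 ≡⟨ homogeneous lin -1ℤ ψ ⟩
  _                 ≡⟨ -1*i≡-i _ ⟩
  _                 ∎

shift : (ℕ → ℤ) → ℕ → ℤ
shift ψ p = ψ (suc p)

-- The transpose of f ↦ n t f + 2 t (1 - t) f′.

spread : ℕ → (ℕ → ℤ) → ℕ → ℤ
spread n ψ p = + 2 * + p * ψ p + (+ n - + 2 * + p) * ψ (suc p)

spread-cong : ∀ n {ψ χ} → ψ ≗ χ → spread n ψ ≗ spread n χ
spread-cong n ψ≗χ p = cong₂ (λ a b → + 2 * + p * a + (+ n - + 2 * + p) * b) (ψ≗χ p) (ψ≗χ (suc p))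

spread-+ : ∀ n ψ χ p → spread n (λ p → ψ p + χ p) p ≡ spread n ψ p + spread n χ p
spread-+ n ψ χ p = lemma (+ p) (+ n) (ψ p) (χ p) (ψ (suc p)) (χ (suc p))
  where
  lemma : ∀ p n a b c d → + 2 * p * (a + b) + (n - + 2 * p) * (c + d)
                        ≡ (+ 2 * p * a + (n - + 2 * p) * c) + (+ 2 * p * b + (n - + 2 * p) * d)
  lemma = solve-∀

spread-* : ∀ n c ψ p → spread n (λ p → c * ψ p) p ≡ c * spread n ψ p
spread-* n c ψ p = lemma (+ p) (+ n) c (ψ p) (ψ (suc p))
  where
  lemma : ∀ p n c a b → + 2 * p * (c * a) + (n - + 2 * p) * (c * b)
                      ≡ c * (+ 2 * p * a + (n - + 2 * p) * b)
  lemma = solve-∀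

spread-linear : ∀ n {F} → Linear F → Linear (λ ψ → F (spread n ψ))
spread-linear n lin = record
  { respects = λ ψ≗χ → respects lin (spread-cong n ψ≗χ)
  ; additive = λ ψ χ → trans (respects lin (spread-+ n ψ χ)) (additive lin _ _)
  ; homogeneous = λ c ψ → trans (respects lin (spread-* n c ψ)) (homogeneous lin c _)
  }

shift-linear : ∀ {F} → Linear F → Linear (λ ψ → F (shift ψ))
shift-linear lin = record
  { respects = λ ψ≗χ → respects lin (λ p → ψ≗χ (suc p))
  ; additive = λ ψ χ → additive lin _ _
  ; homogeneous = λ c ψ → homogeneous lin c _
  }

combination-linear : ∀ a b {F H} → Linear F → Linear H → Linear (λ ψ → a * F ψ + b * H ψ)
combination-linear a b {F} {H} linF linH = record
  { respects = λ ψ≗χ → cong₂ (λ x y → a * x + b * y) (respects linF ψ≗χ) (respects linH ψ≗χ)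
  ; additive = λ ψ χ → trans (cong₂ (λ x y → a * x + b * y) (additive linF ψ χ) (additive linH ψ χ))
                             (add a b (F ψ) (F χ) (H ψ) (H χ))
  ; homogeneous = λ c ψ → trans (cong₂ (λ x y → a * x + b * y) (homogeneous linF c ψ) (homogeneous linH c ψ))
                                (scale a b c (F ψ) (H ψ))
  }
  where
  add : ∀ a b x x′ y y′ → a * (x + x′) + b * (y + y′) ≡ (a * x + b * y) + (a * x′ + b * y′)
  add = solve-∀
  scale : ∀ a b c x y → a * (c * x) + b * (c * y) ≡ c * (a * x + b * y)
  scale = solve-∀

evaluate₀-linear : Linear (λ ψ → ψ 0)
evaluate₀-linear = record
  { respects = λ ψ≗χ → ψ≗χ 0 ; additive = λ _ _ → refl ; homogeneous = λ _ _ → refl }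

zero-linear : Linear (λ _ → 0ℤ)
zero-linear = record
  { respects = λ _ → refl ; additive = λ _ _ → refl ; homogeneous = λ c _ → sym (*-zeroʳ c) }

-- Recurrences of the derangement and Pell polynomials

-- The functional of Dₙ^cpk(t), by the recurrence
-- Dₙ₊₁ = n t (Dₙ₋₁ + Dₙ) + 2 t (1 - t) Dₙ′.

derangementFunctional : ℕ → Functional
derangementFunctional zero ψ = ψ 0
derangementFunctional (suc zero) ψ = 0ℤ
derangementFunctional (suc (suc n)) ψ =
  + suc n * derangementFunctional n (shift ψ) + 1ℤ * derangementFunctional (suc n) (spread (suc n) ψ)

derangementFunctional-linear : ∀ n → Linear (derangementFunctional n)
derangementFunctional-linear zero = evaluate₀-linear
derangementFunctional-linear (suc zero) = zero-linear
derangementFunctional-linear (suc (suc n)) = combination-linear (+ suc n) 1ℤ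
  (shift-linear (derangementFunctional-linear n))
  (spread-linear (suc n) (derangementFunctional-linear (suc n)))

-- Removes the factor `1ℤ`, which makes the defining clause an instance of `combination-linear`, and
-- extends the recurrence to n = 0, where the term with `pred` has coefficient 0 and `spread 0 ψ`
-- vanishes at 0.
derangementFunctional-suc : ∀ n ψ → derangementFunctional (suc n) ψ ≡
  + n * derangementFunctional (pred n) (shift ψ) + derangementFunctional n (spread n ψ)
derangementFunctional-suc zero    ψ = refl
derangementFunctional-suc (suc n) ψ =
  cong₂ _+_ (refl {x = + suc n * derangementFunctional n (shift ψ)}) (*-identityˡ _)

-- The functional of the polynomial gₙ(t) with g₀ = 1, g₁ = 0 and
-- gₙ = 2 gₙ₋₁ - t gₙ₋₂, which is the Pell number gₙ at t = -1.

pellFunctional : ℕ → Functional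
pellFunctional zero ψ = ψ 0
pellFunctional (suc zero) ψ = 0ℤ
pellFunctional (suc (suc n)) ψ = + 2 * pellFunctional (suc n) ψ + -1ℤ * pellFunctional n (shift ψ)

pellFunctional-linear : ∀ n → Linear (pellFunctional n)
pellFunctional-linear zero = evaluate₀-linear
pellFunctional-linear (suc zero) = zero-linear
pellFunctional-linear (suc (suc n)) = combination-linear (+ 2) -1ℤ
  (pellFunctional-linear (suc n)) (shift-linear (pellFunctional-linear n))

-- The same operator as for the derangements occurs here, but the lowering term has the opposite
-- sign; this is what makes the product telescope. The induction step takes twice the case n + 1
-- minus t times the case n. What is left over is n t times gₙ₊₁ - 2 gₙ + t gₙ₋₁, which is 0.
pellFunctional-suc : ∀ n ψ → pellFunctional (suc n) ψ ≡
  - (+ n * pellFunctional (pred n) (shift ψ)) + pellFunctional n (spread n ψ)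
pellFunctional-suc zero ψ = refl
pellFunctional-suc (suc zero) ψ = lemma (ψ 1)
  where
  lemma : ∀ a → + 2 * 0ℤ + -1ℤ * a ≡ - ((+ 1) * a) + 0ℤ
  lemma = solve-∀
pellFunctional-suc (suc (suc n)) ψ = begin
  + 2 * p₂ + -1ℤ * q₁
    ≡⟨ final (+ n) p₂ q₁ q₀ _ _ r (pellFunctional-suc (suc n) ψ) (pellFunctional-suc n (shift ψ)) (vanish n) ⟩
  - ((+ suc (suc n)) * q₁) + (+ 2 * (Γ₁ (spread (suc n) ψ) + q₁) + -1ℤ * (+ 2 * q₀ + pellFunctional n (spread n (shift ψ))))
    ≡⟨ cong₂ (λ a b → - ((+ suc (suc n)) * q₁) + (+ 2 * a + -1ℤ * b)) (sym first) (sym second) ⟩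
  - ((+ suc (suc n)) * q₁) + (+ 2 * Γ₁ (spread (suc (suc n)) ψ) + -1ℤ * pellFunctional n (shift (spread (suc (suc n)) ψ))) ∎
  where
  Γ₁ = pellFunctional (suc n)
  p₂ = pellFunctional (suc (suc n)) ψ
  q₁ = Γ₁ (shift ψ)
  q₀ = pellFunctional n (shift ψ)
  r = pellFunctional (pred n) (shift (shift ψ))
  -- Raising the weight of f ↦ n t f + 2 t (1 - t) f′ by 1 adds t f.
  first : Γ₁ (spread (suc (suc n)) ψ) ≡ Γ₁ (spread (suc n) ψ) + q₁
  first = trans (respects (pellFunctional-linear (suc n))
                   (λ p → lemma (+ suc n) (+ p) (ψ p) (ψ (suc p))))
                (additive (pellFunctional-linear (suc n)) _ _)
    where
    lemma : ∀ n p a b → + 2 * p * a + ((1ℤ + n) - + 2 * p) * b ≡ (+ 2 * p * a + (n - + 2 * p) * b) + b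
    lemma = solve-∀
  -- The product rule for the factor t: the operator of weight n + 2 sends t f to t times the sum of
  -- 2 f and the image of f under the operator of weight n.
  second : pellFunctional n (shift (spread (suc (suc n)) ψ)) ≡ + 2 * q₀ + pellFunctional n (spread n (shift ψ))
  second = begin
    pellFunctional n (shift (spread (suc (suc n)) ψ))
      ≡⟨ respects (pellFunctional-linear n) (λ p → lemma (+ n) (+ p) (ψ (suc p)) (ψ (suc (suc p)))) ⟩
    pellFunctional n (λ p → + 2 * shift ψ p + spread n (shift ψ) p)
      ≡⟨ additive (pellFunctional-linear n) _ _ ⟩
    pellFunctional n (λ p → + 2 * shift ψ p) + _
      ≡⟨ cong₂ _+_ (homogeneous (pellFunctional-linear n) (+ 2) _) refl ⟩
    + 2 * q₀ + pellFunctional n (spread n (shift ψ)) ∎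
    where
    lemma : ∀ n p a b → + 2 * (1ℤ + p) * a + ((1ℤ + (1ℤ + n)) - + 2 * (1ℤ + p)) * b
                      ≡ + 2 * a + (+ 2 * p * a + (n - + 2 * p) * b)
    lemma = solve-∀
  -- The factor m is kept because at m = 0, with `pred 0` = 0, the recurrence itself would be false:
  -- g₁ is 0, but 2 g₀ - t g₀ is not.
  vanish : ∀ m → + m * pellFunctional (suc m) (shift ψ) ≡
    + m * (+ 2 * pellFunctional m (shift ψ) + -1ℤ * pellFunctional (pred m) (shift (shift ψ)))
  vanish zero    = refl
  vanish (suc m) = refl
  final : ∀ n p₂ q₁ q₀ x y r →
          p₂ ≡ - ((1ℤ + n) * q₀) + x → q₁ ≡ - (n * r) + y → n * q₁ ≡ n * (+ 2 * q₀ + -1ℤ * r) →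
          + 2 * p₂ + -1ℤ * q₁
            ≡ - ((1ℤ + (1ℤ + n)) * q₁) + (+ 2 * (x + q₁) + -1ℤ * (+ 2 * q₀ + y))
  final n p₂ q₁ q₀ x y r eqp eqq eq = begin
    + 2 * p₂ + -1ℤ * q₁
      ≡⟨ cong₂ (λ a b → + 2 * a + -1ℤ * b) eqp eqq ⟩
    + 2 * (- ((1ℤ + n) * q₀) + x) + -1ℤ * (- (n * r) + y)
      ≡⟨ expand n q₁ q₀ x y r ⟩
    R + (n * q₁ - n * (+ 2 * q₀ + -1ℤ * r))
      ≡⟨ cong (λ z → R + (z - n * (+ 2 * q₀ + -1ℤ * r))) eq ⟩
    R + (n * (+ 2 * q₀ + -1ℤ * r) - n * (+ 2 * q₀ + -1ℤ * r))
      ≡⟨ cancel R (n * (+ 2 * q₀ + -1ℤ * r)) ⟩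
    R ∎
    where
    R = - ((1ℤ + (1ℤ + n)) * q₁) + (+ 2 * (x + q₁) + -1ℤ * (+ 2 * q₀ + y))
    expand : ∀ n q₁ q₀ x y r → + 2 * (- ((1ℤ + n) * q₀) + x) + -1ℤ * (- (n * r) + y) ≡
      (- ((1ℤ + (1ℤ + n)) * q₁) + (+ 2 * (x + q₁) + -1ℤ * (+ 2 * q₀ + y)))
        + (n * q₁ - n * (+ 2 * q₀ + -1ℤ * r))
    expand = solve-∀
    cancel : ∀ R a → R + (a - a) ≡ R
    cancel = solve-∀

-- The product of the two series

-- The functional of the n-th coefficient of Σ Dₙ^cpk(t) xⁿ/n! · Σ gₙ(t) xⁿ/n!.

productFunctional : ℕ → Functional
productFunctional n ψ = binomialSum n λ k l →
  derangementFunctional k λ p → pellFunctional l λ q → ψ (p ℕ.+ q)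

-- Pascal's rule raises either k or l, so the recurrences of both factors apply.
-- `binomialSum-absorb` carries the lowering terms of the derangements over to those of the Pell
-- polynomials, where they cancel by the opposite sign; the two operators merge into one.
productFunctional-suc : ∀ n ψ → productFunctional (suc n) ψ ≡ productFunctional n (spread n ψ)
productFunctional-suc n ψ = begin
  productFunctional (suc n) ψ
    ≡⟨ binomialSum-cong n step ⟩
  binomialSum n (λ k l → (+ k * X (pred k) l + - (+ l * X k (pred l))) + Y k l)
    ≡⟨ trans (binomialSum-+ n _ Y) (cong₂ _+_ (binomialSum-+ n _ _) (refl {x = binomialSum n Y})) ⟩
  (binomialSum n (λ k l → + k * X (pred k) l) + binomialSum n (λ k l → - (+ l * X k (pred l))))
    + productFunctional n (spread n ψ)
    ≡⟨ cong₂ (λ a b → (a + b) + productFunctional n (spread n ψ)) (binomialSum-absorb n X) (binomialSum-neg n (λ k l → + l * X k (pred l))) ⟩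
  (binomialSum n (λ k l → + l * X k (pred l)) + - binomialSum n (λ k l → + l * X k (pred l)))
    + productFunctional n (spread n ψ)
    ≡⟨ cancel (binomialSum n (λ k l → + l * X k (pred l))) _ ⟩
  productFunctional n (spread n ψ) ∎
  where
  X Y : ℕ → ℕ → ℤ
  X k l = derangementFunctional k λ p → pellFunctional l λ q → ψ (suc (p ℕ.+ q))
  Y k l = derangementFunctional k λ p → pellFunctional l λ q → spread n ψ (p ℕ.+ q)

  cancel : ∀ a b → (a + - a) + b ≡ b
  cancel = solve-∀

  step : ∀ k l → k ℕ.+ l ≡ n →
    derangementFunctional (suc k) (λ p → pellFunctional l λ q → ψ (p ℕ.+ q))
      + derangementFunctional k (λ p → pellFunctional (suc l) λ q → ψ (p ℕ.+ q))
    ≡ (+ k * X (pred k) l + - (+ l * X k (pred l))) + Y k l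
  step k l refl = begin
    derangementFunctional (suc k) (λ p → Γ (ψ⟨ p ⟩))
      + derangementFunctional k (λ p → pellFunctional (suc l) ψ⟨ p ⟩)
      ≡⟨ cong₂ _+_ (derangementFunctional-suc k _) right ⟩
    (+ k * X (pred k) l + E (spread k (λ p → Γ ψ⟨ p ⟩)))
      + (- (+ l * X k (pred l)) + E (λ p → Γ (spread l ψ⟨ p ⟩)))
      ≡⟨ regroup (+ k * X (pred k) l) _ _ _ ⟩
    (+ k * X (pred k) l + - (+ l * X k (pred l)))
      + (E (spread k (λ p → Γ ψ⟨ p ⟩)) + E (λ p → Γ (spread l ψ⟨ p ⟩)))
      ≡⟨ cong₂ _+_ (refl {x = + k * X (pred k) l + - (+ l * X k (pred l))})
           (trans (sym (additive linE _ _)) (respects linE merge)) ⟩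
    (+ k * X (pred k) l + - (+ l * X k (pred l))) + Y k l ∎
    where
    E = derangementFunctional k
    Γ = pellFunctional l
    linE = derangementFunctional-linear k
    linΓ = pellFunctional-linear l
    ψ⟨_⟩ : ℕ → ℕ → ℤ
    ψ⟨ p ⟩ q = ψ (p ℕ.+ q)

    regroup : ∀ a b c d → (a + b) + (c + d) ≡ (a + c) + (b + d)
    regroup = solve-∀

    right : E (λ p → pellFunctional (suc l) ψ⟨ p ⟩)
          ≡ - (+ l * X k (pred l)) + E (λ p → Γ (spread l ψ⟨ p ⟩))
    right = begin
      E (λ p → pellFunctional (suc l) ψ⟨ p ⟩)
        ≡⟨ respects linE (λ p → trans (pellFunctional-suc l ψ⟨ p ⟩)
             (cong₂ (λ a b → - (+ l * a) + b)
               (respects (pellFunctional-linear (pred l)) (λ q → cong ψ (ℕ.+-suc p q)))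
               (refl {x = Γ (spread l ψ⟨ p ⟩)}))) ⟩
      E (λ p → - (+ l * pellFunctional (pred l) ψ⟨ suc p ⟩) + Γ (spread l ψ⟨ p ⟩))
        ≡⟨ additive linE _ _ ⟩
      E (λ p → - (+ l * pellFunctional (pred l) ψ⟨ suc p ⟩)) + E (λ p → Γ (spread l ψ⟨ p ⟩))
        ≡⟨ cong₂ _+_ (trans (linear-neg linE _) (cong -_ (homogeneous linE (+ l) _)))
             (refl {x = E (λ p → Γ (spread l ψ⟨ p ⟩))}) ⟩
      - (+ l * X k (pred l)) + E (λ p → Γ (spread l ψ⟨ p ⟩)) ∎

    -- The product rule: `spread k` acts on the exponent p and `spread l` on q. Their coefficients 2
    -- p, 2 q and k - 2 p, l - 2 q add up to those of weight k + l at the exponent p + q.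
    merge : ∀ p → spread k (λ p → Γ ψ⟨ p ⟩) p + Γ (spread l ψ⟨ p ⟩)
                ≡ Γ (λ q → spread (k ℕ.+ l) ψ (p ℕ.+ q))
    merge p = begin
      (+ 2 * + p * Γ ψ⟨ p ⟩ + (+ k - + 2 * + p) * Γ ψ⟨ suc p ⟩) + Γ (spread l ψ⟨ p ⟩)
        ≡⟨ cong₂ (λ a b → (a + b) + Γ (spread l ψ⟨ p ⟩))
             (sym (homogeneous linΓ (+ 2 * + p) ψ⟨ p ⟩))
             (sym (homogeneous linΓ (+ k - + 2 * + p) ψ⟨ suc p ⟩)) ⟩
      (Γ (λ q → + 2 * + p * ψ⟨ p ⟩ q) + Γ (λ q → (+ k - + 2 * + p) * ψ⟨ suc p ⟩ q)) + Γ (spread l ψ⟨ p ⟩)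
        ≡⟨ cong₂ _+_ (sym (additive linΓ _ _)) (refl {x = Γ (spread l ψ⟨ p ⟩)}) ⟩
      Γ (λ q → + 2 * + p * ψ⟨ p ⟩ q + (+ k - + 2 * + p) * ψ⟨ suc p ⟩ q) + Γ (spread l ψ⟨ p ⟩)
        ≡⟨ sym (additive linΓ _ _) ⟩
      Γ (λ q → (+ 2 * + p * ψ⟨ p ⟩ q + (+ k - + 2 * + p) * ψ⟨ suc p ⟩ q) + spread l ψ⟨ p ⟩ q)
        ≡⟨ respects linΓ (λ q → trans
             (cong (λ z → (+ 2 * + p * ψ⟨ p ⟩ q + (+ k - + 2 * + p) * ψ⟨ suc p ⟩ q)
                            + (+ 2 * + q * ψ⟨ p ⟩ q + (+ l - + 2 * + q) * ψ z)) (ℕ.+-suc p q))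
             (collect (+ p) (+ q) (+ k) (+ l) (ψ⟨ p ⟩ q) (ψ⟨ suc p ⟩ q))) ⟩
      Γ (λ q → spread (k ℕ.+ l) ψ (p ℕ.+ q)) ∎
      where
      collect : ∀ p q k l a b →
        (+ 2 * p * a + (k - + 2 * p) * b) + (+ 2 * q * a + (l - + 2 * q) * b)
        ≡ + 2 * (p + q) * a + ((k + l) - + 2 * (p + q)) * b
      collect = solve-∀

-- The induction replaces ψ by its image under `spread`, so it needs all test sequences at once,
-- that is, the vanishing of the whole polynomial cₙ₊₁ and not just of its value at -1.
productFunctional-vanishes : ∀ n ψ → productFunctional (suc n) ψ ≡ 0ℤ
productFunctional-vanishes zero    ψ = productFunctional-suc 0 ψ
productFunctional-vanishes (suc n) ψ =
  trans (productFunctional-suc (suc n) ψ) (productFunctional-vanishes n (spread (suc n) ψ))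

alternating : ℕ → ℤ
alternating p = -1ℤ ^ p

pellFunctional-alternating : ∀ n → pellFunctional n alternating ≡ + g n
pellFunctional-alternating zero = refl
pellFunctional-alternating (suc zero) = refl
pellFunctional-alternating (suc (suc n)) = begin
  + 2 * pellFunctional (suc n) alternating + -1ℤ * pellFunctional n (shift alternating)
    ≡⟨ cong₂ (λ a b → + 2 * a + -1ℤ * b) (pellFunctional-alternating (suc n))
         (trans (homogeneous (pellFunctional-linear n) -1ℤ alternating)
                (cong (-1ℤ *_) (pellFunctional-alternating n))) ⟩
  + 2 * + g (suc n) + -1ℤ * (-1ℤ * + g n)
    ≡⟨ lemma (+ g (suc n)) (+ g n) ⟩
  + 2 * + g (suc n) + + g n
    ≡⟨ cong (λ a → a + + g n) (sym (pos-* 2 (g (suc n)))) ⟩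
  + g (suc (suc n)) ∎
  where
  lemma : ∀ a b → + 2 * a + -1ℤ * (-1ℤ * b) ≡ + 2 * a + b
  lemma = solve-∀

-- Evaluation at a point is multiplicative: since (-1)ᵖ⁺q = (-1)ᵖ (-1)q with q as exponent
-- throughout, the nested functional factors into two values.
binomialSum-derangement-pell : ∀ n →
  binomialSum n (λ k l → derangementFunctional k alternating * + g l)
    ≡ productFunctional n alternating
binomialSum-derangement-pell n = binomialSum-cong n λ k l _ → sym (begin
  derangementFunctional k (λ p → pellFunctional l λ q → alternating (p ℕ.+ q))
    ≡⟨ respects (derangementFunctional-linear k) (λ p → begin
         pellFunctional l (λ q → alternating (p ℕ.+ q))
           ≡⟨ respects (pellFunctional-linear l) (^-distribˡ-+-* -1ℤ p) ⟩
         pellFunctional l (λ q → alternating p * alternating q)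
           ≡⟨ homogeneous (pellFunctional-linear l) (alternating p) alternating ⟩
         alternating p * pellFunctional l alternating
           ≡⟨ cong (alternating p *_) (pellFunctional-alternating l) ⟩
         alternating p * + g l
           ≡⟨ *-comm (alternating p) (+ g l) ⟩
         + g l * alternating p ∎) ⟩
  derangementFunctional k (λ p → + g l * alternating p)
    ≡⟨ homogeneous (derangementFunctional-linear k) (+ g l) alternating ⟩
  + g l * derangementFunctional k alternating
    ≡⟨ *-comm (+ g l) _ ⟩
  derangementFunctional k alternating * + g l ∎)

-- Inserting a letter into a permutation

lookup-extensional : ∀ {a} {A : Set a} {n} {xs ys : Vec A n} → lookup xs ≗ lookup ys → xs ≡ ys
lookup-extensional {xs = xs} {ys} eq =
  trans (sym (tabulate∘lookup xs)) (trans (tabulate-cong eq) (tabulate∘lookup ys))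

-- Position zero inserts a fixed point 0 into the cycle decomposition of π,
-- position suc i inserts 0 into the arc from i to πᵢ. The old letters are
-- shifted up, so that the new letter is the smallest one.

insert : ∀ {n} → Fin (suc n) → Word n → Word (suc n)
insert zero    π = zero ∷ Vec.map suc π
insert (suc i) π = suc (lookup π i) ∷ (Vec.map suc π [ i ]≔ zero)

lookup-insert-fixed : ∀ {n} (π : Word n) j → lookup (insert zero π) (suc j) ≡ suc (lookup π j)
lookup-insert-fixed π j = lookup-map j suc π

lookup-insert-here : ∀ {n} (π : Word n) i → lookup (insert (suc i) π) (suc i) ≡ zero
lookup-insert-here π i = lookup∘update i (Vec.map suc π) zero

lookup-insert-there : ∀ {n} (π : Word n) {i j} → j ≢ i →
                      lookup (insert (suc i) π) (suc j) ≡ suc (lookup π j)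
lookup-insert-there π {i} {j} j≢i =
  trans (lookup∘update′ j≢i (Vec.map suc π) zero) (lookup-map j suc π)

-- The insertion position is the preimage of `zero`. The one value of the old word that the
-- insertion overwrites is kept in the head.
insert-injective : ∀ {n} {k l : Fin (suc n)} {π ρ : Word n} →
                   insert k π ≡ insert l ρ → k ≡ l × π ≡ ρ
insert-injective {k = zero} {zero} {π} {ρ} eq = refl , lookup-extensional λ j → suc-injective (begin
  suc (lookup π j)                ≡⟨ lookup-insert-fixed π j ⟨
  lookup (insert zero π) (suc j)  ≡⟨ cong (λ σ → lookup σ (suc j)) eq ⟩
  lookup (insert zero ρ) (suc j)  ≡⟨ lookup-insert-fixed ρ j ⟩
  suc (lookup ρ j)                ∎)
  where open ≡-Reasoning
insert-injective {k = zero}  {suc l} eq = contradiction (cong Vec.head eq) 0≢1+n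
insert-injective {k = suc k} {zero}  eq = contradiction (sym (cong Vec.head eq)) 0≢1+n
insert-injective {k = suc k} {suc l} {π} {ρ} eq with k ≟ l
... | no k≢l = contradiction
  (trans (sym (lookup-insert-here π k)) (trans (cong (λ σ → lookup σ (suc k)) eq) (lookup-insert-there ρ k≢l)))
  0≢1+n
... | yes refl = refl , lookup-extensional pointwise
  where
  pointwise : lookup π ≗ lookup ρ
  pointwise j with j ≟ k
  ... | yes refl = suc-injective (cong Vec.head eq)
  ... | no j≢k = suc-injective (trans (sym (lookup-insert-there π j≢k))
                   (trans (cong (λ σ → lookup σ (suc j)) eq) (lookup-insert-there ρ j≢k)))

insert-isPermutation : ∀ {n} k {π : Word n} → IsPermutation π → IsPermutation (insert k π)
insert-isPermutation zero {π} (injective , surjective) = injective′ , strictlySurjective⇒surjective surjective′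
  where
  injective′ : ∀ {a b} → lookup (insert zero π) a ≡ lookup (insert zero π) b → a ≡ b
  injective′ {zero}  {zero}  _ = refl
  injective′ {zero}  {suc b} eq = contradiction (trans eq (lookup-insert-fixed π b)) 0≢1+n
  injective′ {suc a} {zero}  eq = contradiction (trans (sym eq) (lookup-insert-fixed π a)) 0≢1+n
  injective′ {suc a} {suc b} eq = cong suc (injective (suc-injective
    (trans (sym (lookup-insert-fixed π a)) (trans eq (lookup-insert-fixed π b)))))
  surjective′ : ∀ y → ∃ λ x → lookup (insert zero π) x ≡ y
  surjective′ zero = zero , refl
  surjective′ (suc y) with surjective y
  ... | x , πx≡y = suc x , trans (lookup-insert-fixed π x) (cong suc (πx≡y refl))
insert-isPermutation (suc i) {π} (injective , surjective) = injective′ , strictlySurjective⇒surjective surjective′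
  where
  σ = lookup (insert (suc i) π)
  head≢ : ∀ b → suc (lookup π i) ≢ σ (suc b)
  head≢ b eq with b ≟ i
  ... | yes refl = 0≢1+n (sym (trans eq (lookup-insert-here π i)))
  ... | no b≢i = b≢i (sym (injective (suc-injective (trans eq (lookup-insert-there π b≢i)))))
  injective′ : ∀ {a b} → σ a ≡ σ b → a ≡ b
  injective′ {zero}  {zero}  _ = refl
  injective′ {zero}  {suc b} eq = contradiction eq (head≢ b)
  injective′ {suc a} {zero}  eq = contradiction (sym eq) (head≢ a)
  injective′ {suc a} {suc b} eq with a ≟ i | b ≟ i
  ... | yes refl | yes refl = refl
  ... | yes refl | no b≢i = contradiction
        (trans (sym (lookup-insert-here π i)) (trans eq (lookup-insert-there π b≢i))) 0≢1+n
  ... | no a≢i | yes refl = contradiction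
        (trans (sym (lookup-insert-here π i)) (trans (sym eq) (lookup-insert-there π a≢i))) 0≢1+n
  ... | no a≢i | no b≢i = cong suc (injective (suc-injective
        (trans (sym (lookup-insert-there π a≢i)) (trans eq (lookup-insert-there π b≢i)))))
  surjective′ : ∀ y → ∃ λ x → σ x ≡ y
  surjective′ zero = suc i , lookup-insert-here π i
  surjective′ (suc y) with surjective y
  ... | x , πx≡y with x ≟ i
  ... | yes refl = zero , cong suc (πx≡y refl)
  ... | no x≢i = suc x , trans (lookup-insert-there π x≢i) (cong suc (πx≡y refl))

insert-isPermutation⁻ : ∀ {n} k {π : Word n} → IsPermutation (insert k π) → IsPermutation π
insert-isPermutation⁻ zero {π} (injective , surjective) =
  (λ {a} {b} eq → suc-injective (injective
    (trans (lookup-insert-fixed π a) (trans (cong suc eq) (sym (lookup-insert-fixed π b)))))) ,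
  strictlySurjective⇒surjective surjective′
  where
  surjective′ : ∀ y → ∃ λ x → lookup π x ≡ y
  surjective′ y with surjective (suc y)
  ... | zero  , eq = contradiction (eq refl) 0≢1+n
  ... | suc x , eq = x , suc-injective (trans (sym (lookup-insert-fixed π x)) (eq refl))
insert-isPermutation⁻ (suc i) {π} (injective , surjective) = injective′ , strictlySurjective⇒surjective surjective′
  where
  injective′ : ∀ {a b} → lookup π a ≡ lookup π b → a ≡ b
  injective′ {a} {b} eq with a ≟ i | b ≟ i
  ... | yes refl | yes refl = refl
  ... | yes refl | no b≢i =
        contradiction (injective {zero} {suc b} (trans (cong suc eq) (sym (lookup-insert-there π b≢i)))) 0≢1+n
  ... | no a≢i | yes refl =
        contradiction (injective {zero} {suc a} (trans (cong suc (sym eq)) (sym (lookup-insert-there π a≢i)))) 0≢1+n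
  ... | no a≢i | no b≢i = suc-injective (injective
        (trans (lookup-insert-there π a≢i) (trans (cong suc eq) (sym (lookup-insert-there π b≢i)))))
  surjective′ : ∀ y → ∃ λ x → lookup π x ≡ y
  surjective′ y with surjective (suc y)
  ... | zero , eq = i , suc-injective (eq refl)
  ... | suc x , eq with x ≟ i
  ... | yes refl = contradiction (trans (sym (lookup-insert-here π x)) (eq refl)) 0≢1+n
  ... | no x≢i = x , suc-injective (trans (sym (lookup-insert-there π x≢i)) (eq refl))

-- Deleting `zero` from its cycle joins its predecessor to its successor. The predecessor exists by
-- surjectivity and is the insertion position; injectivity keeps all other letters away from `zero`,
-- so they can be shifted down.
insert-surjective : ∀ {n} (σ : Word (suc n)) → IsPermutation σ → ∃₂ λ k π → σ ≡ insert k π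
insert-surjective {n} (zero ∷ w) (injective , _) = zero , π , lookup-extensional pointwise
  where
  w≢0 : ∀ j → zero ≢ lookup w j
  w≢0 j eq = 0≢1+n (injective {zero} {suc j} eq)
  π : Word n
  π = Vec.tabulate λ j → punchOut (w≢0 j)
  pointwise : lookup (zero ∷ w) ≗ lookup (insert zero π)
  pointwise zero = refl
  pointwise (suc j) = sym (trans (lookup-insert-fixed π j)
    (trans (cong suc (lookup∘tabulate _ j)) (punchIn-punchOut (w≢0 j))))
insert-surjective {n} (suc y ∷ w) (injective , surjective) with surjective zero
... | zero  , eq = contradiction (sym (eq refl)) 0≢1+n
... | suc i , eq = suc i , π , lookup-extensional pointwise
  where
  wᵢ≡0 : lookup w i ≡ zero
  wᵢ≡0 = eq refl
  -- The value is bundled with the equations that it satisfies in either case, so that `pointwise`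
  -- can use them without unfolding this case distinction. At i the value is y, the successor of the
  -- deleted letter.
  old : ∀ j → ∃ λ u → (j ≡ i → u ≡ y) × (j ≢ i → suc u ≡ lookup w j)
  old j with j ≟ i
  ... | yes j≡i = y , (λ _ → refl) , λ j≢i → contradiction j≡i j≢i
  ... | no j≢i = punchOut wⱼ≢0 , (λ j≡i → contradiction j≡i j≢i) , λ _ → punchIn-punchOut wⱼ≢0
    where
    wⱼ≢0 : zero ≢ lookup w j
    wⱼ≢0 0≡wⱼ = j≢i (suc-injective (injective (trans (sym 0≡wⱼ) (sym wᵢ≡0))))
  π : Word n
  π = Vec.tabulate (proj₁ ∘ old)
  pointwise : lookup (suc y ∷ w) ≗ lookup (insert (suc i) π)
  pointwise zero = cong suc (sym (trans (lookup∘tabulate _ i) (proj₁ (proj₂ (old i)) refl)))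
  pointwise (suc j) with j ≟ i
  ... | yes refl = trans wᵢ≡0 (sym (lookup-insert-here π i))
  ... | no j≢i = sym (trans (lookup-insert-there π j≢i)
                   (trans (cong suc (lookup∘tabulate _ j)) (proj₂ (proj₂ (old j)) j≢i)))

allVecs-complete : ∀ m {n} (v : Vec (Fin m) n) → v ∈ allVecs m n
allVecs-complete m []      = here refl
allVecs-complete m (x ∷ v) = ∈-cartesianProductWith⁺ Vec._∷_ (∈-allFin x) (allVecs-complete m v)

allVecs-unique : ∀ m n → Unique (allVecs m n)
allVecs-unique m zero    = [] ∷ []
allVecs-unique m (suc n) = cartesianProductWith⁺ Vec._∷_ ∷-injective (allFin⁺ m) (allVecs-unique m n)

permutations : ∀ n → List (Word n)
permutations n = filter isPermutation? (allVecs n n)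

-- Both lists are free of duplicates and have the same members, hence agree as bags. Equality up to
-- reordering is enough for sums.
permutations-suc : ∀ n →
  permutations (suc n) ↭ cartesianProductWith insert (allFin (suc n)) (permutations n)
permutations-suc n = ∼bag⇒↭ (unique∧set⇒bag
  (filter⁺ isPermutation? (allVecs-unique (suc n) (suc n)))
  (cartesianProductWith⁺ insert insert-injective (allFin⁺ (suc n))
    (filter⁺ isPermutation? (allVecs-unique n n)))
  (mk⇔ to from))
  where
  to : ∀ {σ} → σ ∈ permutations (suc n) → σ ∈ cartesianProductWith insert (allFin (suc n)) (permutations n)
  to {σ} σ∈ with ∈-filter⁻ isPermutation? {xs = allVecs (suc n) (suc n)} σ∈
  ... | _ , perm with insert-surjective σ perm
  ... | k , π , refl = ∈-cartesianProductWith⁺ insert (∈-allFin k)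
        (∈-filter⁺ isPermutation? (allVecs-complete n π) (insert-isPermutation⁻ k perm))
  from : ∀ {σ} → σ ∈ cartesianProductWith insert (allFin (suc n)) (permutations n) → σ ∈ permutations (suc n)
  from σ∈ with ∈-cartesianProductWith⁻ insert (allFin (suc n)) (permutations n) σ∈
  ... | k , π , _ , π∈ , refl = ∈-filter⁺ isPermutation? (allVecs-complete (suc n) (insert k π))
        (insert-isPermutation k (proj₂ (∈-filter⁻ isPermutation? {xs = allVecs n n} π∈)))

-- Fixed points and cyclic peaks under insertion

-- Integer-valued, so that statistics become sums whose differences and products are open to ring
-- identities.
indicator : ∀ {p} {P : Set p} → Dec P → ℤ
indicator (yes _) = 1ℤ
indicator (no _)  = 0ℤ

indicator-yes : ∀ {p} {P : Set p} (P? : Dec P) → P → indicator P? ≡ 1ℤ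
indicator-yes (yes _) _ = refl
indicator-yes (no ¬p) p = contradiction p ¬p

indicator-no : ∀ {p} {P : Set p} (P? : Dec P) → ¬ P → indicator P? ≡ 0ℤ
indicator-no (yes p) ¬p = contradiction p ¬p
indicator-no (no _)  _  = refl

indicator-⇔ : ∀ {p q} {P : Set p} {Q : Set q} (P? : Dec P) (Q? : Dec Q) →
              (P → Q) → (Q → P) → indicator P? ≡ indicator Q?
indicator-⇔ (yes p) Q? P⇒Q _ = sym (indicator-yes Q? (P⇒Q p))
indicator-⇔ (no ¬p) Q? _ Q⇒P = sym (indicator-no Q? (¬p ∘ Q⇒P))

indicator-× : ∀ {p q} {P : Set p} {Q : Set q} (P? : Dec P) (Q? : Dec Q) →
              indicator (P? ×-dec Q?) ≡ indicator P? * indicator Q?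
indicator-× (yes _) (yes _) = refl
indicator-× (yes _) (no _)  = refl
indicator-× (no _)  _       = refl

length-filter-tabulate : ∀ {a p} {A : Set a} {P : Pred A p} (P? : Decidable P) {n} (f : Fin n → A) →
  + length (filter P? (List.tabulate f)) ≡ sum (indicator ∘ P? ∘ f)
length-filter-tabulate P? {zero} f = refl
length-filter-tabulate P? {suc n} f with P? (f zero)
... | yes _ = cong₂ _+_ (refl {x = 1ℤ}) (length-filter-tabulate P? (f ∘ suc))
... | no _  = trans (length-filter-tabulate P? (f ∘ suc)) (sym (+-identityˡ _))

sum-const : ∀ n c → sum {n} (λ _ → c) ≡ + n * c
sum-const zero    c = refl
sum-const (suc n) c = trans (cong₂ _+_ (refl {x = c}) (sum-const n c)) (lemma (+ n) c)
  where
  lemma : ∀ n c → c + n * c ≡ (1ℤ + n) * c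
  lemma = solve-∀

sum-δ : ∀ {n} (i : Fin n) c → sum (λ j → indicator (j ≟ i) * c) ≡ c
sum-δ {suc n} zero c = trans (cong₂ _+_ (lemma c) (trans (sum-const n 0ℤ) (*-zeroʳ (+ n)))) (+-identityʳ c)
  where
  lemma : ∀ c → 1ℤ * c ≡ c
  lemma = solve-∀
sum-δ {suc n} (suc i) c = trans (+-identityˡ _) (trans
  (sum-cong-≗ λ j → cong (_* c) (indicator-⇔ (suc j ≟ suc i) (j ≟ i) suc-injective (cong suc)))
  (sum-δ i c))

fixedPoints : ∀ {n} → Word n → ℕ
fixedPoints {n} π = length (filter (λ i → lookup π i ≟ i) (allFin n))

module _ {n} (π : Word n) where

  ascent descent fixed peak : Fin n → ℤ
  ascent  i = indicator (i <? lookup π i)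
  descent i = indicator (lookup π i <? i)
  fixed   i = indicator (lookup π i ≟ i)
  peak    i = indicator (isCyclicPeak? π i)

  cpk-sum : + cpk π ≡ sum peak
  cpk-sum = length-filter-tabulate (isCyclicPeak? π) id

  fixedPoints-sum : + fixedPoints π ≡ sum fixed
  fixedPoints-sum = length-filter-tabulate (λ i → lookup π i ≟ i) id

  peak-× : ∀ i → peak i ≡ ascent i * descent (lookup π i)
  peak-× i = indicator-× (i <? lookup π i) (lookup π (lookup π i) <? lookup π i)

  trichotomy : ∀ i → ascent i + descent i + fixed i ≡ 1ℤ
  trichotomy i with <-cmp i (lookup π i)
  ... | tri< a b c = cong₂ _+_ (cong₂ _+_ (indicator-yes (_ <? _) a) (indicator-no (_ <? _) c)) (indicator-no (_ ≟ _) (b ∘ sym))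
  ... | tri≈ a b c = cong₂ _+_ (cong₂ _+_ (indicator-no (_ <? _) a) (indicator-no (_ <? _) c)) (indicator-yes (_ ≟ _) (sym b))
  ... | tri> a b c = cong₂ _+_ (cong₂ _+_ (indicator-no (_ <? _) a) (indicator-yes (_ <? _) c)) (indicator-no (_ ≟ _) (b ∘ sym))

module Insertion {n} (π : Word n) (perm : IsPermutation π) where

  p₊ f₊ : ℤ
  p₊ = + cpk π
  f₊ = + fixedPoints π

  injective : ∀ {i j} → lookup π i ≡ lookup π j → i ≡ j
  injective = proj₁ perm

  π⁻¹ : Fin n → Fin n
  π⁻¹ j = proj₁ (proj₂ perm j)

  π∘π⁻¹ : ∀ j → lookup π (π⁻¹ j) ≡ j
  π∘π⁻¹ j = proj₂ (proj₂ perm j) refl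

  π⁻¹∘π : ∀ j → π⁻¹ (lookup π j) ≡ j
  π⁻¹∘π j = injective (π∘π⁻¹ (lookup π j))

  sum-reindex : ∀ (h : Fin n → ℤ) → sum h ≡ sum (h ∘ lookup π)
  sum-reindex h = sum-permute h (permutation (lookup π) π⁻¹ π∘π⁻¹ π⁻¹∘π)

  -- The change of the number of cyclic peaks when a new smallest letter is
  -- inserted into the arc from i to πᵢ ≠ i: it is 1 if πᵢ is a double
  -- descent or i is a double ascent, and 0 otherwise.

  gain : Fin n → ℤ
  gain i = descent π (lookup π i) + (ascent π (π⁻¹ i) * ascent π i + -1ℤ * peak π i)

  -- After an ascent the next letter is not a fixed point, by injectivity, so it continues with
  -- either an ascent or a descent; the descent makes it a cyclic peak.
  consecutive-ascents : ∀ j → ascent π j * ascent π (lookup π j) + peak π j ≡ ascent π j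
  consecutive-ascents j = begin
    ascent π j * ascent π (lookup π j) + peak π j
      ≡⟨ cong₂ _+_ (refl {x = ascent π j * ascent π (lookup π j)}) (peak-× π j) ⟩
    ascent π j * ascent π (lookup π j) + ascent π j * descent π (lookup π j)
      ≡⟨ expand (ascent π j) (ascent π (lookup π j)) (descent π (lookup π j)) (fixed π (lookup π j)) ⟩
    ascent π j * (ascent π (lookup π j) + descent π (lookup π j) + fixed π (lookup π j))
      - ascent π j * fixed π (lookup π j)
      ≡⟨ cong₂ (λ a b → ascent π j * a - b) (trichotomy π (lookup π j)) vanish ⟩
    ascent π j * 1ℤ - 0ℤ
      ≡⟨ simplify (ascent π j) ⟩
    ascent π j ∎
    where
    expand : ∀ a b c d → a * b + a * c ≡ a * (b + c + d) - a * d
    expand = solve-∀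
    simplify : ∀ a → a * 1ℤ - 0ℤ ≡ a
    simplify = solve-∀
    vanish : ascent π j * fixed π (lookup π j) ≡ 0ℤ
    vanish with lookup π (lookup π j) ≟ lookup π j
    ... | yes eq = cong (_* 1ℤ) (indicator-no (j <? lookup π j) (<-irrefl (sym (injective eq))))
    ... | no _ = *-zeroʳ (ascent π j)

  -- An arc that is not a loop has gain 0 exactly if it enters or leaves a cyclic valley, and every
  -- cycle has as many valleys as peaks; this is the origin of 2 p₊. The computation avoids valleys:
  -- double ascents and peaks make up the ascents, which together with descents and fixed points
  -- number n. The peaks are missing once from the double ascents and are subtracted once more by
  -- `gain`.
  sum-gain : sum gain ≡ + n - f₊ - + 2 * p₊
  sum-gain = begin
    sum gain
      ≡⟨ ∑-distrib-+ (descent π ∘ lookup π) (λ i → ascent π (π⁻¹ i) * ascent π i + -1ℤ * peak π i) ⟩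
    sum (descent π ∘ lookup π) + sum (λ i → ascent π (π⁻¹ i) * ascent π i + -1ℤ * peak π i)
      ≡⟨ cong₂ _+_ (sym (sum-reindex (descent π)))
           (∑-distrib-+ (λ i → ascent π (π⁻¹ i) * ascent π i) (λ i → -1ℤ * peak π i)) ⟩
    sum (descent π) + (sum (λ i → ascent π (π⁻¹ i) * ascent π i) + sum (λ i → -1ℤ * peak π i))
      ≡⟨ cong₂ (λ a b → sum (descent π) + (a + b)) reindexed
           (trans (sym (*-distribˡ-sum -1ℤ (peak π))) (cong (-1ℤ *_) (sym (cpk-sum π)))) ⟩
    sum (descent π) + (x + -1ℤ * p₊)
      ≡⟨ arrange (sum (descent π)) x p₊ f₊ ⟩
    ((x + p₊) + sum (descent π) + f₊) - f₊ - + 2 * p₊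
      ≡⟨ cong (λ a → a - f₊ - + 2 * p₊) total ⟩
    + n - f₊ - + 2 * p₊ ∎
    where
    x = sum (λ j → ascent π j * ascent π (lookup π j))
    arrange : ∀ d x p f → d + (x + -1ℤ * p) ≡ ((x + p) + d + f) - f - + 2 * p
    arrange = solve-∀
    reindexed : sum (λ i → ascent π (π⁻¹ i) * ascent π i) ≡ x
    reindexed = trans (sum-reindex _)
      (sum-cong-≗ λ j → cong (λ a → ascent π a * ascent π (lookup π j)) (π⁻¹∘π j))
    total : (x + p₊) + sum (descent π) + f₊ ≡ + n
    total = begin
      (x + p₊) + sum (descent π) + f₊
        ≡⟨ cong₂ (λ a b → (x + a) + sum (descent π) + b) (cpk-sum π) (fixedPoints-sum π) ⟩
      (x + sum (peak π)) + sum (descent π) + sum (fixed π)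
        ≡⟨ cong (λ a → a + sum (descent π) + sum (fixed π))
             (trans (sym (∑-distrib-+ (λ j → ascent π j * ascent π (lookup π j)) (peak π)))
                    (sum-cong-≗ consecutive-ascents)) ⟩
      sum (ascent π) + sum (descent π) + sum (fixed π)
        ≡⟨ cong (_+ sum (fixed π)) (∑-distrib-+ (ascent π) (descent π)) ⟨
      sum (λ i → ascent π i + descent π i) + sum (fixed π)
        ≡⟨ ∑-distrib-+ (λ i → ascent π i + descent π i) (fixed π) ⟨
      sum (λ i → ascent π i + descent π i + fixed π i)
        ≡⟨ sum-cong-≗ (trichotomy π) ⟩
      sum {n} (λ _ → 1ℤ)
        ≡⟨ sum-const n 1ℤ ⟩
      + n * 1ℤ
        ≡⟨ identity (+ n) ⟩
      + n ∎
      where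
      identity : ∀ a → a * 1ℤ ≡ a
      identity = solve-∀

  peak-lift : ∀ {σ : Word (suc n)} {j} → lookup σ (suc j) ≡ suc (lookup π j) →
              lookup σ (suc (lookup π j)) ≡ suc (lookup π (lookup π j)) → peak σ (suc j) ≡ peak π j
  peak-lift {σ} {j} eq eq′ = indicator-⇔ (isCyclicPeak? σ (suc j)) (isCyclicPeak? π j) to from
    where
    to : IsCyclicPeak σ (suc j) → IsCyclicPeak π j
    to rewrite eq | eq′ = λ (a , b) → s<s⁻¹ a , s<s⁻¹ b
    from : IsCyclicPeak π j → IsCyclicPeak σ (suc j)
    from rewrite eq | eq′ = λ (a , b) → s<s a , s<s b

  fixed-lift : ∀ {σ : Word (suc n)} {j} → lookup σ (suc j) ≡ suc (lookup π j) → fixed σ (suc j) ≡ fixed π j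
  fixed-lift {σ} {j} eq = indicator-⇔ (lookup σ (suc j) ≟ suc j) (lookup π j ≟ j)
    (λ eq₁ → suc-injective (trans (sym eq) eq₁)) (λ eq₁ → trans eq (cong suc eq₁))

  cpk-insert-zero : cpk (insert zero π) ≡ cpk π
  cpk-insert-zero = +-injective (begin
    + cpk σ ≡⟨ cpk-sum σ ⟩
    peak σ zero + sum (peak σ ∘ suc)
      ≡⟨ cong₂ _+_ (indicator-no (isCyclicPeak? σ zero) λ ()) (sum-cong-≗ λ j →
           peak-lift {σ} {j} (lookup-insert-fixed π j) (lookup-insert-fixed π (lookup π j))) ⟩
    0ℤ + sum (peak π) ≡⟨ +-identityˡ _ ⟩
    sum (peak π)      ≡⟨ cpk-sum π ⟨
    + cpk π ∎)
    where σ = insert zero π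

  fixedPoints-insert-zero : fixedPoints (insert zero π) ≡ suc (fixedPoints π)
  fixedPoints-insert-zero = +-injective (begin
    + fixedPoints σ ≡⟨ fixedPoints-sum σ ⟩
    1ℤ + sum (fixed σ ∘ suc)
      ≡⟨ cong₂ _+_ (refl {x = 1ℤ}) (trans (sum-cong-≗ λ j → fixed-lift {σ} {j} (lookup-insert-fixed π j)) (sym (fixedPoints-sum π))) ⟩
    + suc (fixedPoints π) ∎)
    where σ = insert zero π

  module _ (i : Fin n) where

    σ : Word (suc n)
    σ = insert (suc i) π

    δ : Fin n → Fin n → ℤ
    δ k j = indicator (j ≟ k)

    δ-same : ∀ {j k} → j ≡ k → δ k j ≡ 1ℤ
    δ-same {j} {k} = indicator-yes (j ≟ k)

    δ-other : ∀ {j k} → j ≢ k → δ k j ≡ 0ℤ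
    δ-other {j} {k} = indicator-no (j ≟ k)

    peak-here : peak σ (suc i) ≡ 0ℤ
    peak-here = indicator-no (isCyclicPeak? σ (suc i)) not-peak
      where
      not-peak : ¬ IsCyclicPeak σ (suc i)
      not-peak rewrite lookup-insert-here π i = λ { (() , _) }

    fixedPoints-insert-suc : + fixedPoints σ ≡ f₊ + -1ℤ * fixed π i
    fixedPoints-insert-suc = begin
      + fixedPoints σ ≡⟨ fixedPoints-sum σ ⟩
      0ℤ + sum (fixed σ ∘ suc) ≡⟨ +-identityˡ _ ⟩
      sum (fixed σ ∘ suc) ≡⟨ sum-cong-≗ pointwise ⟩
      sum (λ j → fixed π j + δ i j * (-1ℤ * fixed π i))
        ≡⟨ ∑-distrib-+ (fixed π) (λ j → δ i j * (-1ℤ * fixed π i)) ⟩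
      sum (fixed π) + sum (λ j → δ i j * (-1ℤ * fixed π i))
        ≡⟨ cong₂ _+_ (sym (fixedPoints-sum π)) (sum-δ i (-1ℤ * fixed π i)) ⟩
      f₊ + -1ℤ * fixed π i ∎
      where
      cancel : ∀ a → 0ℤ ≡ a + 1ℤ * (-1ℤ * a)
      cancel = solve-∀
      pointwise : ∀ j → fixed σ (suc j) ≡ fixed π j + δ i j * (-1ℤ * fixed π i)
      pointwise j with j ≟ i
      ... | yes refl = trans
            (indicator-no (lookup σ (suc i) ≟ suc i) λ eq → 0≢1+n (trans (sym (lookup-insert-here π i)) eq))
            (cancel (fixed π i))
      ... | no j≢i = trans (fixed-lift {σ} {j} (lookup-insert-there π j≢i)) (sym (+-identityʳ _))

    -- The loop at i becomes a 2-cycle with the new letter, whose one peak is at position `zero`.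
    -- This rise is not recorded by `gain`, which is 0 at a fixed point.
    cpk-insert-fixed : lookup π i ≡ i → + cpk σ ≡ p₊ + 1ℤ
    cpk-insert-fixed πi≡i = begin
      + cpk σ ≡⟨ cpk-sum σ ⟩
      peak σ zero + sum (peak σ ∘ suc)
        ≡⟨ cong₂ _+_ (indicator-yes (isCyclicPeak? σ zero) peak-zero) (sum-cong-≗ pointwise) ⟩
      1ℤ + sum (peak π) ≡⟨ cong₂ _+_ (refl {x = 1ℤ}) (sym (cpk-sum π)) ⟩
      1ℤ + p₊ ≡⟨ comm p₊ ⟩
      p₊ + 1ℤ ∎
      where
      comm : ∀ a → 1ℤ + a ≡ a + 1ℤ
      comm = solve-∀
      peak-zero : IsCyclicPeak σ zero
      peak-zero = z<s , subst (_< suc (lookup π i))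
        (sym (trans (cong (lookup σ ∘ suc) πi≡i) (lookup-insert-here π i))) z<s
      pointwise : ∀ j → peak σ (suc j) ≡ peak π j
      pointwise j with j ≟ i
      ... | yes refl = trans peak-here (sym (indicator-no (isCyclicPeak? π i) λ (i<πi , _) → <-irrefl (sym πi≡i) i<πi))
      ... | no j≢i = peak-lift {σ} {j} (lookup-insert-there π j≢i)
            (lookup-insert-there π λ πj≡i → j≢i (injective (trans πj≡i (sym πi≡i))))

    module _ (πi≢i : lookup π i ≢ i) where

      ascent+descent : ascent π i + descent π i ≡ 1ℤ
      ascent+descent = begin
        ascent π i + descent π i ≡⟨ +-identityʳ _ ⟨
        ascent π i + descent π i + 0ℤ ≡⟨ cong₂ _+_ (refl {x = ascent π i + descent π i}) (indicator-no (lookup π i ≟ i) πi≢i) ⟨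
        ascent π i + descent π i + fixed π i ≡⟨ trichotomy π i ⟩
        1ℤ ∎

      peak-before : peak σ (suc (π⁻¹ i)) ≡ ascent π (π⁻¹ i)
      peak-before = indicator-⇔ (isCyclicPeak? σ (suc (π⁻¹ i))) (π⁻¹ i <? lookup π (π⁻¹ i)) to from
        where
        h = π⁻¹ i
        h≢i : h ≢ i
        h≢i h≡i = πi≢i (trans (cong (lookup π) (sym h≡i)) (π∘π⁻¹ i))
        σh : lookup σ (suc h) ≡ suc i
        σh = trans (lookup-insert-there π h≢i) (cong suc (π∘π⁻¹ i))
        to : IsCyclicPeak σ (suc h) → h < lookup π h
        to rewrite σh | π∘π⁻¹ i = λ (a , _) → s<s⁻¹ a
        from : h < lookup π h → IsCyclicPeak σ (suc h)
        from rewrite σh | π∘π⁻¹ i | lookup-insert-here π i = λ a → s<s a , z<s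

      peak-first : peak σ zero ≡ descent π (lookup π i)
      peak-first = indicator-⇔ (isCyclicPeak? σ zero) (lookup π (lookup π i) <? lookup π i) to from
        where
        to : IsCyclicPeak σ zero → lookup π (lookup π i) < lookup π i
        to rewrite lookup-insert-there π πi≢i = λ (_ , a) → s<s⁻¹ a
        from : lookup π (lookup π i) < lookup π i → IsCyclicPeak σ zero
        from rewrite lookup-insert-there π πi≢i = λ a → z<s , s<s a

      -- Two old positions are affected. The letter i, at position π⁻¹ i, is now followed by the
      -- smallest letter, so an ascent before it suffices for a peak; this is new if it was followed
      -- by an ascent. Position i now holds `zero` and loses any peak; the letter πᵢ has moved to
      -- position `zero`, which `peak-first` treats.
      peak-pointwise : ∀ j → peak σ (suc j) ≡
        peak π j + (δ (π⁻¹ i) j * (ascent π (π⁻¹ i) * ascent π i) + δ i j * (-1ℤ * peak π i))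
      peak-pointwise j = split (j ≟ i) (j ≟ π⁻¹ i)
        where
        c = ascent π (π⁻¹ i) * ascent π i
        d = -1ℤ * peak π i
        split : Dec (j ≡ i) → Dec (j ≡ π⁻¹ i) → peak σ (suc j) ≡ peak π j + (δ (π⁻¹ i) j * c + δ i j * d)
        split (yes refl) (yes eq) = contradiction (trans (cong (lookup π) eq) (π∘π⁻¹ i)) πi≢i
        split (yes refl) (no j≢h) = begin
          peak σ (suc i) ≡⟨ peak-here ⟩
          0ℤ ≡⟨ lemma (peak π i) c ⟩
          peak π i + (0ℤ * c + 1ℤ * (-1ℤ * peak π i))
            ≡⟨ cong₂ (λ a b → peak π i + (a * c + b * d)) (sym (δ-other j≢h)) (sym (δ-same {i} refl)) ⟩
          peak π i + (δ (π⁻¹ i) i * c + δ i i * d) ∎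
          where
          lemma : ∀ a c → 0ℤ ≡ a + (0ℤ * c + 1ℤ * (-1ℤ * a))
          lemma = solve-∀
        split (no j≢i) (yes refl) = begin
          peak σ (suc h) ≡⟨ peak-before ⟩
          ascent π h ≡⟨ lemma₁ (ascent π h) ⟩
          ascent π h * 1ℤ ≡⟨ cong (ascent π h *_) ascent+descent ⟨
          ascent π h * (ascent π i + descent π i) ≡⟨ lemma₂ (ascent π h) (ascent π i) (descent π i) d ⟩
          ascent π h * descent π i + (1ℤ * c + 0ℤ * d)
            ≡⟨ cong (λ a → ascent π h * descent π a + (1ℤ * c + 0ℤ * d)) (π∘π⁻¹ i) ⟨
          ascent π h * descent π (lookup π h) + (1ℤ * c + 0ℤ * d)
            ≡⟨ cong (_+ (1ℤ * c + 0ℤ * d)) (peak-× π h) ⟨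
          peak π h + (1ℤ * c + 0ℤ * d)
            ≡⟨ cong₂ (λ a b → peak π h + (a * c + b * d)) (sym (δ-same {h} refl)) (sym (δ-other j≢i)) ⟩
          peak π h + (δ h h * c + δ i h * d) ∎
          where
          h = π⁻¹ i
          lemma₁ : ∀ a → a ≡ a * 1ℤ
          lemma₁ = solve-∀
          lemma₂ : ∀ a b c d → a * (b + c) ≡ a * c + (1ℤ * (a * b) + 0ℤ * d)
          lemma₂ = solve-∀
        split (no j≢i) (no j≢h) = begin
          peak σ (suc j)
            ≡⟨ peak-lift {σ} {j} (lookup-insert-there π j≢i) (lookup-insert-there π λ πj≡i →
                 j≢h (trans (sym (π⁻¹∘π j)) (cong π⁻¹ πj≡i))) ⟩
          peak π j ≡⟨ lemma (peak π j) c d ⟩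
          peak π j + (0ℤ * c + 0ℤ * d)
            ≡⟨ cong₂ (λ a b → peak π j + (a * c + b * d)) (sym (δ-other j≢h)) (sym (δ-other j≢i)) ⟩
          peak π j + (δ (π⁻¹ i) j * c + δ i j * d) ∎
          where
          lemma : ∀ a c d → a ≡ a + (0ℤ * c + 0ℤ * d)
          lemma = solve-∀

      cpk-insert-nonfixed : + cpk σ ≡ p₊ + gain i
      cpk-insert-nonfixed = begin
        + cpk σ ≡⟨ cpk-sum σ ⟩
        peak σ zero + sum (peak σ ∘ suc)
          ≡⟨ cong₂ _+_ peak-first (trans (sum-cong-≗ peak-pointwise) (∑-distrib-+ (peak π) _)) ⟩
        descent π (lookup π i) + (sum (peak π) + sum (λ j → δ (π⁻¹ i) j * c + δ i j * d))
          ≡⟨ cong₂ (λ a b → descent π (lookup π i) + (a + b)) (sym (cpk-sum π))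
               (trans (∑-distrib-+ (λ j → δ (π⁻¹ i) j * c) (λ j → δ i j * d))
                      (cong₂ _+_ (sum-δ (π⁻¹ i) c) (sum-δ i d))) ⟩
        descent π (lookup π i) + (p₊ + (c + d))
          ≡⟨ lemma (descent π (lookup π i)) p₊ (c + d) ⟩
        p₊ + gain i ∎
        where
        c = ascent π (π⁻¹ i) * ascent π i
        d = -1ℤ * peak π i
        lemma : ∀ a b c → a + (b + c) ≡ b + (a + c)
        lemma = solve-∀

indicator-bit : ∀ {p} {P : Set p} (P? : Dec P) → indicator P? ≡ 0ℤ ⊎ indicator P? ≡ 1ℤ
indicator-bit (yes _) = inj₂ refl
indicator-bit (no _)  = inj₁ refl

-- The sum of φ(fix σ, cpk σ) over the words σ obtained from a permutation π
-- of size n, in terms of f = fix π and p = cpk π.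

insertionSum : ℕ → (ℕ → ℕ → ℤ) → ℕ → ℕ → ℤ
insertionSum n φ f p =
  φ (suc f) p + (+ f * φ (pred f) (suc p) + (+ 2 * + p * φ f p + (+ n - + f - + 2 * + p) * φ f (suc p)))

module _ {n} (π : Word n) (perm : IsPermutation π) where
  open Insertion π perm

  gain-formula : ∀ {a} i → ascent π i ≡ a →
    gain i ≡ descent π (lookup π i) + (ascent π (π⁻¹ i) * a + -1ℤ * (a * descent π (lookup π i)))
  gain-formula i refl = cong (λ b → descent π (lookup π i) + (ascent π (π⁻¹ i) * ascent π i + -1ℤ * b)) (peak-× π i)

  gain-no-ascent : ∀ i → ascent π i ≡ 0ℤ → gain i ≡ descent π (lookup π i)
  gain-no-ascent i a≡0 = trans (gain-formula i a≡0) (lemma (descent π (lookup π i)) (ascent π (π⁻¹ i)))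
    where
    lemma : ∀ d a → d + (a * 0ℤ + -1ℤ * (0ℤ * d)) ≡ d
    lemma = solve-∀

  gain-ascent : ∀ i → ascent π i ≡ 1ℤ → gain i ≡ ascent π (π⁻¹ i)
  gain-ascent i a≡1 = trans (gain-formula i a≡1) (lemma (descent π (lookup π i)) (ascent π (π⁻¹ i)))
    where
    lemma : ∀ d a → d + (a * 1ℤ + -1ℤ * (1ℤ * d)) ≡ a
    lemma = solve-∀

  gain-bit : ∀ i → gain i ≡ 0ℤ ⊎ gain i ≡ 1ℤ
  gain-bit i with indicator-bit (i <? lookup π i)
  ... | inj₁ a≡0 rewrite gain-no-ascent i a≡0 = indicator-bit (_ <? _)
  ... | inj₂ a≡1 rewrite gain-ascent i a≡1 = indicator-bit (_ <? _)

  gain-fixed : ∀ i → lookup π i ≡ i → gain i ≡ 0ℤ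
  gain-fixed i πi≡i = trans
    (gain-no-ascent i (indicator-no (i <? lookup π i) (<-irrefl (sym πi≡i))))
    (indicator-no (_ <? _) (<-irrefl (cong (lookup π) πi≡i)))

  private
    f p : ℕ
    f = fixedPoints π
    p = cpk π

  -- `fixed` and `gain` are bits that are never both 1, so any φ of the new statistics is an affine
  -- function of them. Thus the sum over i depends only on the totals of `fixed` and `gain`.
  insert-suc-value : ∀ (φ : ℕ → ℕ → ℤ) i →
    φ (fixedPoints (insert (suc i) π)) (cpk (insert (suc i) π)) ≡
    φ f p + (fixed π i * (φ (pred f) (suc p) - φ f p) + gain i * (φ f (suc p) - φ f p))
  insert-suc-value φ i = split (lookup π i ≟ i) (gain-bit i)
    where
    rhs : ℤ → ℤ → ℤ
    rhs a b = φ f p + (a * (φ (pred f) (suc p) - φ f p) + b * (φ f (suc p) - φ f p))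

    only-fixed : ∀ a b c → b ≡ a + (1ℤ * (b - a) + 0ℤ * (c - a))
    only-fixed = solve-∀
    neither : ∀ a b c → a ≡ a + (0ℤ * (b - a) + 0ℤ * (c - a))
    neither = solve-∀
    only-gain : ∀ a b c → c ≡ a + (0ℤ * (b - a) + 1ℤ * (c - a))
    only-gain = solve-∀
    add-back : ∀ a b → a + -1ℤ * b + b ≡ a
    add-back = solve-∀

    fixedPoints-insert : ∀ {b} → fixed π i ≡ + b → fixedPoints (insert (suc i) π) ℕ.+ b ≡ f
    fixedPoints-insert {b} fix≡b = +-injective (trans
      (cong₂ _+_ (trans (fixedPoints-insert-suc i) (cong (λ a → + f + -1ℤ * a) fix≡b)) (refl {x = + b}))
      (add-back (+ f) (+ b)))

    nonfixed : lookup π i ≢ i → fixedPoints (insert (suc i) π) ≡ f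
    nonfixed πi≢i = trans (sym (ℕ.+-identityʳ _)) (fixedPoints-insert (indicator-no (lookup π i ≟ i) πi≢i))

    cpk-insert : ∀ {b} → lookup π i ≢ i → gain i ≡ + b → cpk (insert (suc i) π) ≡ b ℕ.+ p
    cpk-insert {b} πi≢i gain≡b = trans
      (+-injective (trans (cpk-insert-nonfixed i πi≢i) (cong (λ a → + p + a) gain≡b))) (ℕ.+-comm p b)

    split : Dec (lookup π i ≡ i) → gain i ≡ 0ℤ ⊎ gain i ≡ 1ℤ →
            φ (fixedPoints (insert (suc i) π)) (cpk (insert (suc i) π)) ≡ rhs (fixed π i) (gain i)
    split (yes πi≡i) _ = begin
      φ (fixedPoints (insert (suc i) π)) (cpk (insert (suc i) π))
        ≡⟨ cong₂ φ
             (cong pred (trans (ℕ.+-comm 1 _) (fixedPoints-insert (indicator-yes (lookup π i ≟ i) πi≡i))))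
             (trans (+-injective (cpk-insert-fixed i πi≡i)) (ℕ.+-comm p 1)) ⟩
      φ (pred f) (suc p)
        ≡⟨ only-fixed (φ f p) (φ (pred f) (suc p)) (φ f (suc p)) ⟩
      rhs 1ℤ 0ℤ
        ≡⟨ cong₂ rhs (sym (indicator-yes (lookup π i ≟ i) πi≡i)) (sym (gain-fixed i πi≡i)) ⟩
      rhs (fixed π i) (gain i) ∎
    split (no πi≢i) (inj₁ gain≡0) = begin
      φ (fixedPoints (insert (suc i) π)) (cpk (insert (suc i) π))
        ≡⟨ cong₂ φ (nonfixed πi≢i) (cpk-insert πi≢i gain≡0) ⟩
      φ f p
        ≡⟨ neither (φ f p) (φ (pred f) (suc p)) (φ f (suc p)) ⟩
      rhs 0ℤ 0ℤ
        ≡⟨ cong₂ rhs (sym (indicator-no (lookup π i ≟ i) πi≢i)) (sym gain≡0) ⟩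
      rhs (fixed π i) (gain i) ∎
    split (no πi≢i) (inj₂ gain≡1) = begin
      φ (fixedPoints (insert (suc i) π)) (cpk (insert (suc i) π))
        ≡⟨ cong₂ φ (nonfixed πi≢i) (cpk-insert πi≢i gain≡1) ⟩
      φ f (suc p)
        ≡⟨ only-gain (φ f p) (φ (pred f) (suc p)) (φ f (suc p)) ⟩
      rhs 0ℤ 1ℤ
        ≡⟨ cong₂ rhs (sym (indicator-no (lookup π i ≟ i) πi≢i)) (sym gain≡1) ⟩
      rhs (fixed π i) (gain i) ∎

  sum-insert : ∀ (φ : ℕ → ℕ → ℤ) →
    sum (λ k → φ (fixedPoints (insert k π)) (cpk (insert k π))) ≡ insertionSum n φ f p
  sum-insert φ = begin
    φ (fixedPoints (insert zero π)) (cpk (insert zero π))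
      + sum (λ i → φ (fixedPoints (insert (suc i) π)) (cpk (insert (suc i) π)))
      ≡⟨ cong₂ _+_ (cong₂ φ fixedPoints-insert-zero cpk-insert-zero) (sum-cong-≗ (insert-suc-value φ)) ⟩
    φ (suc f) p + sum (λ i → a + (fixed π i * b + gain i * c))
      ≡⟨ cong₂ _+_ (refl {x = φ (suc f) p}) (trans
           (∑-distrib-+ (λ _ → a) (λ i → fixed π i * b + gain i * c))
           (cong₂ _+_ (sum-const n a) (trans
             (∑-distrib-+ (λ i → fixed π i * b) (λ i → gain i * c))
             (cong₂ _+_
               (trans (sym (*-distribʳ-sum b (fixed π))) (cong (_* b) (sym (fixedPoints-sum π))))
               (trans (sym (*-distribʳ-sum c gain)) (cong (_* c) sum-gain)))))) ⟩
    φ (suc f) p + (+ n * a + (+ f * b + (+ n - + f - + 2 * + p) * c))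
      ≡⟨ lemma (φ (suc f) p) (+ n) (+ f) (+ p) a (φ (pred f) (suc p)) (φ f (suc p)) ⟩
    insertionSum n φ f p ∎
    where
    a = φ f p
    b = φ (pred f) (suc p) - φ f p
    c = φ f (suc p) - φ f p
    lemma : ∀ s n f p a b c →
      s + (n * a + (f * (b - a) + (n - f - + 2 * p) * (c - a)))
      ≡ s + (f * b + (+ 2 * p * a + (n - f - + 2 * p) * c))
    lemma = solve-∀

-- Sums over all permutations and over derangements

listSum : ∀ {a} {A : Set a} → (A → ℤ) → List A → ℤ
listSum h xs = foldr _+_ 0ℤ (map h xs)

module _ {a} {A : Set a} where

  listSum-↭ : ∀ (h : A → ℤ) {xs ys} → xs ↭ ys → listSum h xs ≡ listSum h ys
  listSum-↭ h xs↭ys = foldr-commMonoid (setoid ℤ) +-0-isCommutativeMonoid (↭⇒↭ₛ (map⁺ h xs↭ys))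

  listSum-++ : ∀ (h : A → ℤ) xs ys → listSum h (xs ++ ys) ≡ listSum h xs + listSum h ys
  listSum-++ h []       ys = sym (+-identityˡ _)
  listSum-++ h (x ∷ xs) ys = trans (cong (λ z → h x + z) (listSum-++ h xs ys)) (sym (+-assoc (h x) _ _))

  listSum-+ : ∀ (h h′ : A → ℤ) xs → listSum (λ x → h x + h′ x) xs ≡ listSum h xs + listSum h′ xs
  listSum-+ h h′ []       = refl
  listSum-+ h h′ (x ∷ xs) = trans (cong (λ z → h x + h′ x + z) (listSum-+ h h′ xs))
                                  (interchange (h x) (h′ x) (listSum h xs) (listSum h′ xs))
    where
    interchange : ∀ a b c d → (a + b) + (c + d) ≡ (a + c) + (b + d)
    interchange = solve-∀

  listSum-0 : ∀ (xs : List A) → listSum (λ _ → 0ℤ) xs ≡ 0ℤ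
  listSum-0 []       = refl
  listSum-0 (x ∷ xs) = trans (+-identityˡ _) (listSum-0 xs)

  listSum-tabulate : ∀ (h : A → ℤ) {n} (f : Fin n → A) → listSum h (List.tabulate f) ≡ sum (h ∘ f)
  listSum-tabulate h {zero}  f = refl
  listSum-tabulate h {suc n} f = cong (λ z → h (f zero) + z) (listSum-tabulate h (f ∘ suc))

  listSum-filter-cong : ∀ {p} {P : Pred A p} (P? : Decidable P) {h h′ : A → ℤ} → (∀ x → P x → h x ≡ h′ x) →
                        ∀ xs → listSum h (filter P? xs) ≡ listSum h′ (filter P? xs)
  listSum-filter-cong P? h≡h′ [] = refl
  listSum-filter-cong P? h≡h′ (x ∷ xs) with P? x
  ... | yes px = cong₂ _+_ (h≡h′ x px) (listSum-filter-cong P? h≡h′ xs)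
  ... | no _   = listSum-filter-cong P? h≡h′ xs

listSum-map : ∀ {a b} {A : Set a} {B : Set b} (h : B → ℤ) (f : A → B) xs →
              listSum h (map f xs) ≡ listSum (h ∘ f) xs
listSum-map h f []       = refl
listSum-map h f (x ∷ xs) = cong (λ z → h (f x) + z) (listSum-map h f xs)

-- The order of summation is exchanged so that, for each π, the inner sum runs over all insertion
-- positions, as in `sum-insert`.
listSum-cartesianProductWith : ∀ {a b c} {A : Set a} {B : Set b} {C : Set c} (h : C → ℤ) (f : A → B → C) xs ys →
  listSum h (cartesianProductWith f xs ys) ≡ listSum (λ y → listSum (λ x → h (f x y)) xs) ys
listSum-cartesianProductWith h f []       ys = sym (listSum-0 ys)
listSum-cartesianProductWith h f (x ∷ xs) ys = begin
  listSum h (map (f x) ys ++ cartesianProductWith f xs ys)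
    ≡⟨ listSum-++ h (map (f x) ys) _ ⟩
  listSum h (map (f x) ys) + listSum h (cartesianProductWith f xs ys)
    ≡⟨ cong₂ _+_ (listSum-map h (f x) ys) (listSum-cartesianProductWith h f xs ys) ⟩
  listSum (λ y → h (f x y)) ys + listSum (λ y → listSum (λ x → h (f x y)) xs) ys
    ≡⟨ listSum-+ (λ y → h (f x y)) _ ys ⟨
  listSum (λ y → listSum (λ x → h (f x y)) (x ∷ xs)) ys ∎

statisticSum : ∀ n → (ℕ → ℕ → ℤ) → ℤ
statisticSum n φ = listSum (λ π → φ (fixedPoints π) (cpk π)) (permutations n)

statisticSum-suc : ∀ n φ → statisticSum (suc n) φ ≡ statisticSum n (insertionSum n φ)
statisticSum-suc n φ = begin
  listSum h (permutations (suc n))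
    ≡⟨ listSum-↭ h (permutations-suc n) ⟩
  listSum h (cartesianProductWith insert (allFin (suc n)) (permutations n))
    ≡⟨ listSum-cartesianProductWith h insert (allFin (suc n)) (permutations n) ⟩
  listSum (λ π → listSum (λ k → h (insert k π)) (allFin (suc n))) (permutations n)
    ≡⟨ listSum-filter-cong isPermutation? (λ π perm →
         trans (listSum-tabulate (λ k → h (insert k π)) id) (sum-insert π perm φ)) (allVecs n n) ⟩
  statisticSum n (insertionSum n φ) ∎
  where
  h : ∀ {m} → Word m → ℤ
  h σ = φ (fixedPoints σ) (cpk σ)

-- A permutation is a set of j fixed points together with a derangement of
-- the remaining m letters.

statisticSum-binomial : ∀ n φ → statisticSum n φ ≡ binomialSum n λ j m → derangementFunctional m (φ j)
statisticSum-binomial zero    φ = +-identityʳ _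
statisticSum-binomial (suc n) φ = begin
  statisticSum (suc n) φ
    ≡⟨ statisticSum-suc n φ ⟩
  statisticSum n (insertionSum n φ)
    ≡⟨ statisticSum-binomial n (insertionSum n φ) ⟩
  binomialSum n (λ j m → E m (insertionSum n φ j))
    ≡⟨ binomialSum-cong n expand ⟩
  binomialSum n (λ j m → E m (φ (suc j)) + (+ j * X (pred j) m + Z j m))
    ≡⟨ split (λ j m → + j * X (pred j) m) ⟩
  A + (binomialSum n (λ j m → + j * X (pred j) m) + binomialSum n Z)
    -- Opening one of j fixed points into a 2-cycle with the new letter is the same as choosing the
    -- partner of the new letter among the m letters outside the fixed points. This yields the term
    -- with `pred m` in the derangement recurrence.
    ≡⟨ cong (λ z → A + (z + binomialSum n Z)) (binomialSum-absorb n X) ⟩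
  A + (binomialSum n (λ j m → + m * X j (pred m)) + binomialSum n Z)
    ≡⟨ split (λ j m → + m * X j (pred m)) ⟨
  binomialSum n (λ j m → E m (φ (suc j)) + (+ m * X j (pred m) + Z j m))
    ≡⟨ binomialSum-cong n (λ j m _ → cong (λ z → E m (φ (suc j)) + z) (sym (derangementFunctional-suc m (φ j)))) ⟩
  binomialSum (suc n) (λ j m → E m (φ j)) ∎
  where
  E = derangementFunctional
  X Z : ℕ → ℕ → ℤ
  X j m = E m (shift (φ j))
  Z j m = E m (spread m (φ j))
  A = binomialSum n λ j m → E m (φ (suc j))
  split : ∀ f → binomialSum n (λ j m → E m (φ (suc j)) + (f j m + Z j m)) ≡ A + (binomialSum n f + binomialSum n Z)
  split f = trans (binomialSum-+ n (λ j m → E m (φ (suc j))) (λ j m → f j m + Z j m))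
                  (cong (λ z → A + z) (binomialSum-+ n f Z))
  drop-j : ∀ j m p → (j + m) - j - + 2 * p ≡ m - + 2 * p
  drop-j = solve-∀
  expand : ∀ j m → j ℕ.+ m ≡ n → E m (insertionSum n φ j) ≡ E m (φ (suc j)) + (+ j * X (pred j) m + Z j m)
  expand j m refl = begin
    E m (insertionSum (j ℕ.+ m) φ j)
      ≡⟨ respects lin (λ p → cong
           (λ z → φ (suc j) p + (+ j * φ (pred j) (suc p) + (+ 2 * + p * φ j p + z * φ j (suc p))))
           (drop-j (+ j) (+ m) (+ p))) ⟩
    E m (λ p → φ (suc j) p + (+ j * φ (pred j) (suc p) + spread m (φ j) p))
      ≡⟨ additive lin _ _ ⟩
    E m (φ (suc j)) + E m (λ p → + j * φ (pred j) (suc p) + spread m (φ j) p)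
      ≡⟨ cong (λ z → E m (φ (suc j)) + z) (trans (additive lin _ _)
           (cong (λ z → z + Z j m) (homogeneous lin (+ j) (shift (φ (pred j)))))) ⟩
    E m (φ (suc j)) + (+ j * X (pred j) m + Z j m) ∎
    where lin = derangementFunctional-linear m

-- The test function that gives fixed points the weight 0, so that the joint statistic over
-- permutations specializes to derangements.
withoutFixedPoints : (ℕ → ℤ) → ℕ → ℕ → ℤ
withoutFixedPoints ψ zero    p = ψ p
withoutFixedPoints ψ (suc _) p = 0ℤ

fixedPoints-0 : ∀ {n} {π : Word n} → FixedPointFree π → fixedPoints π ≡ 0
fixedPoints-0 {π = π} free = cong length (filter-none (λ i → lookup π i ≟ i) {xs = allFin _} (All.tabulate λ {i} _ → free i))

withoutFixedPoints-free : ∀ {n} {π : Word n} ψ p → FixedPointFree π → withoutFixedPoints ψ (fixedPoints π) p ≡ ψ p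
withoutFixedPoints-free {π = π} ψ p free rewrite fixedPoints-0 {π = π} free = refl

withoutFixedPoints-fixed : ∀ {n} {π : Word n} ψ p → ¬ FixedPointFree π → withoutFixedPoints ψ (fixedPoints π) p ≡ 0ℤ
withoutFixedPoints-fixed {n} {π} ψ p ¬free with filter (λ i → lookup π i ≟ i) (allFin n) in eq
... | _ ∷ _ = refl
... | []    = contradiction (λ i πi≡i → absurd (subst (i ∈_) eq
                (∈-filter⁺ (λ i → lookup π i ≟ i) (∈-allFin i) πi≡i))) ¬free
  where
  absurd : ∀ {i : Fin n} → ¬ (i ∈ [])
  absurd ()

listSum-derangements : ∀ {n} ψ (xs : List (Word n)) →
  listSum (ψ ∘ cpk) (filter isDerangement? xs)
    ≡ listSum (λ π → withoutFixedPoints ψ (fixedPoints π) (cpk π)) (filter isPermutation? xs)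
listSum-derangements ψ [] = refl
listSum-derangements ψ (π ∷ xs) = split (isDerangement? π) (isPermutation? π)
  where
  h : Word _ → ℤ
  h π = withoutFixedPoints ψ (fixedPoints π) (cpk π)
  split : Dec (IsDerangement π) → Dec (IsPermutation π) →
          listSum (ψ ∘ cpk) (filter isDerangement? (π ∷ xs)) ≡ listSum h (filter isPermutation? (π ∷ xs))
  split (yes (perm , free)) _ = begin
    listSum (ψ ∘ cpk) (filter isDerangement? (π ∷ xs))
      ≡⟨ cong (listSum (ψ ∘ cpk)) (filter-accept isDerangement? (perm , free)) ⟩
    ψ (cpk π) + listSum (ψ ∘ cpk) (filter isDerangement? xs)
      ≡⟨ cong₂ _+_ (sym (withoutFixedPoints-free {π = π} ψ (cpk π) free)) (listSum-derangements ψ xs) ⟩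
    h π + listSum h (filter isPermutation? xs)
      ≡⟨ cong (listSum h) (filter-accept isPermutation? perm) ⟨
    listSum h (filter isPermutation? (π ∷ xs)) ∎
  split (no ¬der) (yes perm) = begin
    listSum (ψ ∘ cpk) (filter isDerangement? (π ∷ xs))
      ≡⟨ cong (listSum (ψ ∘ cpk)) (filter-reject isDerangement? ¬der) ⟩
    listSum (ψ ∘ cpk) (filter isDerangement? xs)
      ≡⟨ listSum-derangements ψ xs ⟩
    listSum h (filter isPermutation? xs)
      ≡⟨ +-identityˡ _ ⟨
    0ℤ + listSum h (filter isPermutation? xs)
      ≡⟨ cong (_+ listSum h (filter isPermutation? xs))
           (withoutFixedPoints-fixed {π = π} ψ (cpk π) (λ free → ¬der (perm , free))) ⟨
    h π + listSum h (filter isPermutation? xs)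
      ≡⟨ cong (listSum h) (filter-accept isPermutation? perm) ⟨
    listSum h (filter isPermutation? (π ∷ xs)) ∎
  split (no ¬der) (no ¬perm) = begin
    listSum (ψ ∘ cpk) (filter isDerangement? (π ∷ xs))
      ≡⟨ cong (listSum (ψ ∘ cpk)) (filter-reject isDerangement? ¬der) ⟩
    listSum (ψ ∘ cpk) (filter isDerangement? xs)
      ≡⟨ listSum-derangements ψ xs ⟩
    listSum h (filter isPermutation? xs)
      ≡⟨ cong (listSum h) (filter-reject isPermutation? ¬perm) ⟨
    listSum h (filter isPermutation? (π ∷ xs)) ∎

-- Evaluation at t = -1

derangements-alternating : ∀ n → D[ n ]^cpk -1ℤ ≡ derangementFunctional n alternating
derangements-alternating n = begin
  D[ n ]^cpk -1ℤ
    ≡⟨ listSum-derangements alternating (allVecs n n) ⟩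
  statisticSum n (withoutFixedPoints alternating)
    ≡⟨ statisticSum-binomial n (withoutFixedPoints alternating) ⟩
  binomialSum n (λ j m → derangementFunctional m (withoutFixedPoints alternating j))
    -- Positive numbers of fixed points contribute 0, so only j = 0 and m = n remain, with binomial
    -- coefficient 1.
    ≡⟨ binomialSum-first n _ (λ i m → linear-0 (derangementFunctional-linear m) λ _ → refl) ⟩
  derangementFunctional n alternating ∎

derangements-pell : ∀ n → binomialSum (suc n) (λ k l → D[ k ]^cpk -1ℤ * + g l) ≡ 0ℤ
derangements-pell n = begin
  binomialSum (suc n) (λ k l → D[ k ]^cpk -1ℤ * + g l)
    ≡⟨ binomialSum-cong (suc n) (λ k l _ → cong (_* + g l) (derangements-alternating k)) ⟩
  binomialSum (suc n) (λ k l → derangementFunctional k alternating * + g l)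
    ≡⟨ binomialSum-derangement-pell (suc n) ⟩
  productFunctional (suc n) alternating
    ≡⟨ productFunctional-vanishes n alternating ⟩
  0ℤ ∎

pell-derangements : ∀ n → binomialSum (suc n) (λ k l → + g k * D[ l ]^cpk -1ℤ) ≡ 0ℤ
pell-derangements n = begin
  binomialSum (suc n) (λ k l → + g k * D[ l ]^cpk -1ℤ)
    ≡⟨ binomialSum-cong (suc n) (λ k l _ → *-comm (+ g k) (D[ l ]^cpk -1ℤ)) ⟩
  binomialSum (suc n) (λ k l → D[ l ]^cpk -1ℤ * + g k)
    ≡⟨ binomialSum-swap (suc n) (λ k l → D[ k ]^cpk -1ℤ * + g l) ⟩
  binomialSum (suc n) (λ k l → D[ k ]^cpk -1ℤ * + g l)
    ≡⟨ derangements-pell n ⟩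
  0ℤ ∎

corollary13 : D^cpk -1ℤ IsInverseOf G
corollary13 =
  (λ n → trans (exponential-⊛ d p (D^cpk-exponential -1ℤ) G-exponential n)
               (exponential-one (λ n → binomialSum n λ k l → d k * p l) refl derangements-pell n)) ,
  (λ n → trans (exponential-⊛ p d G-exponential (D^cpk-exponential -1ℤ) n)
               (exponential-one (λ n → binomialSum n λ k l → p k * d l) refl pell-derangements n))
  where
  d p : ℕ → ℤ
  d n = D[ n ]^cpk -1ℤ
  p n = + g n
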